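{- Let $n>4$ and let $W_n$ be the wheel graph on $n$ vertices. Then $T_3(W_n)=\left\lfloor \frac{n}{2}\right\rfloor+2$.
   Context: The wheel graph $W_n$ consists of a cycle on $n-1$ vertices (the outer cycle) together with one additional vertex (the hub) adjacent to every vertex of the cycle. A tile is a vertex together with a finite multiset of half-edges, each half-edge labeled by a cohesive-end symbol $a$ or its complement $\hat a$, where $a$ ranges over an alphabet of bond-edge types. A pot $P$ is a finite set of distinct tile types. A graph $G$ (loops and multiple edges allowed) is realized by $P$ if each vertex of $G$ can be assigned a copy of some tile type in $P$ (any number of copies of each type may be used) so that the half-edges at each vertex are in bijection with the edge-ends at that vertex and every edge of $G$ is formed by joining a half-edge labeled $a$ with a half-edge labeled $\hat a$ for some bond-edge type $a$, with no half-edge left unmatched. $C_{min}(P)$ is the set of graphs of minimum order among all graphs realized by $P$. In Scenario 3 a pot $P$ is admissible for a target graph $G$ if $C_{min}(P)=\{G\}$ up to isomorphism, i.e. $P$ realizes $G$, realizes no graph of smaller order, and realizes no graph of the same order nonisomorphic to $G$. $T_3(G)$ is the minimum number of tile types over all pots admissible for $G$ in Scenario 3. -}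

module Defs where

open import Data.Nat using (ℕ; zero; suc; _≤_)
open import Data.Bool using (Bool; true; false; not; if_then_else_)
open import Data.Fin using (Fin; zero; suc; inject₁; fromℕ; _≟_)
open import Data.Product using (Σ; _×_; _,_; proj₁; proj₂)
open import Data.Sum using (_⊎_)
open import Data.List using (List; []; _∷_; [_]; _++_; length; lookup; map; concatMap; allFin)
open import Data.List.Relation.Binary.Permutation.Propositional using (_↭_)
open import Data.List.Relation.Unary.AllPairs using (AllPairs)
open import Relation.Nullary using (¬_)
open import Relation.Nullary.Decidable using (⌊_⌋)
open import Relation.Binary.PropositionalEquality using (_≡_)
open import Function.Bundles using (_↔_; Inverse)

-- Bond-edge types are drawn from the (countable) alphabet ℕ.
-- A cohesive-end symbol is a bond-edge type together with a flag:
-- (a , false) is  a,  (a , true) is  â.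
Label : Set
Label = ℕ × Bool

comp : Label → Label
comp (a , h) = (a , not h)

-- A tile type: its finite multiset of half-edge labels (a list taken
-- up to permutation).
Tile : Set
Tile = List Label

Pot : Set
Pot = List Tile

DistinctTiles : Pot → Set
DistinctTiles P = AllPairs (λ s t → ¬ (s ↭ t)) P

-- Finite multigraphs (loops and multiple edges allowed)

record Graph : Set where
  field
    order : ℕ
    edges : List (Fin order × Fin order)
open Graph public

SameEnds : {n : ℕ} → Fin n × Fin n → Fin n × Fin n → Set
SameEnds (u , w) (u' , w') = (u ≡ u' × w ≡ w') ⊎ (u ≡ w' × w ≡ u')

Iso : Graph → Graph → Set
Iso G H =
  Σ (Fin (order G) ↔ Fin (order H)) λ σ →
  Σ (Fin (length (edges G)) ↔ Fin (length (edges H))) λ π →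
  (k : Fin (length (edges G))) →
    let e = lookup (edges G) k in
    SameEnds (Inverse.to σ (proj₁ e) , Inverse.to σ (proj₂ e))
             (lookup (edges H) (Inverse.to π k))

-- Given labels for the first end of each edge (the second end receives
-- the complementary label), the list of labels on the edge-ends at v.
endLabels : (G : Graph) → (Fin (length (edges G)) → Label) →
            Fin (order G) → List Label
endLabels G lab v = concatMap f (allFin (length (edges G)))
  where
  f : Fin (length (edges G)) → List Label
  f k = (if ⌊ proj₁ (lookup (edges G) k) ≟ v ⌋ then [ lab k ] else [])
     ++ (if ⌊ proj₂ (lookup (edges G) k) ≟ v ⌋ then [ comp (lab k) ] else [])

-- P realizes G: each vertex gets a tile type of P, each edge gets a
-- bond-edge type with one end a and the other â, and at every vertex
-- the half-edges of its tile are in bijection with its edge-ends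
-- (equal label multisets).
Realizes : Pot → Graph → Set
Realizes P G =
  Σ (Fin (order G) → Fin (length P)) λ τ →
  Σ (Fin (length (edges G)) → Label) λ lab →
  (v : Fin (order G)) → endLabels G lab v ↭ lookup P (τ v)

-- C_min(P) = {G} up to isomorphism.  Graphs are taken to have at least
-- one vertex (otherwise the empty graph is realized by every pot).
Admissible3 : Pot → Graph → Set
Admissible3 P G =
  DistinctTiles P ×
  Realizes P G ×
  ((H : Graph) → 1 ≤ order H → Realizes P H → order G ≤ order H) ×
  ((H : Graph) → Realizes P H → order H ≡ order G → Iso H G)

T3Is : Graph → ℕ → Set
T3Is G t =
  (Σ Pot λ P → Admissible3 P G × length P ≡ t) ×
  ((P : Pot) → Admissible3 P G → t ≤ length P)

-- Wheel graph W_n.  For n = k + 2: hub = vertex 0, outer cycle on the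
-- k + 1 vertices 1 , … , k + 1 in this cyclic order.  (Only n > 4 is
-- used; for n < 2 an edgeless placeholder is returned.)

wheel : ℕ → Graph
wheel zero = record { order = zero ; edges = [] }
wheel (suc zero) = record { order = suc zero ; edges = [] }
wheel (suc (suc k)) = record { order = suc (suc k) ; edges = es }
  where
  es : List (Fin (suc (suc k)) × Fin (suc (suc k)))
  es = map (λ i → (suc (inject₁ i) , suc (suc i))) (allFin k)
    ++ ((suc (fromℕ k) , suc zero) ∷ [])
    ++ map (λ j → (zero , suc j)) (allFin (suc k))

{-# OPTIONS --safe #-}

-- Lower bound.  Exchanging the ends of two equally labelled edges of a realization
-- of the wheel must give the wheel again.  Hence labels of rim edges, read in the
-- cyclic direction, are pairwise distinct (otherwise the hub becomes a cut vertex),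
-- and no spoke shares a label with a rim edge at another vertex (otherwise a double
-- edge appears).  So two rim vertices x ≠ y with equal tiles have their rim labels
-- interchanged; a tile is used at most twice, and if it is used at x and y, then
-- walking from x and y towards each other one meets, on each of the two arcs, a
-- vertex whose tile is used only once.  With the hub this makes three such vertices,
-- so n + 3 ≤ 2 ∣P∣.
--
-- Upper bound.  Orient the rim away from a root vertex, along two arms whose edges
-- carry the same labels in the same order, down to a common last vertex (if the rim
-- has odd length, one arm starts with an extra edge with a label of its own).  In any
-- graph realized by the resulting pot the two arms and a hub can be traced and are
-- pairwise disjoint except possibly at their ends; this forces at least n vertices,
-- and, when there are exactly n, it forces the arms to meet.

module Submission where

open import Defs
open import Data.Nat as ℕ using (ℕ; zero; suc; _≤_; _<_; _+_; _*_; _∸_; z≤n; s≤s; z<s)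
open import Data.Nat.DivMod using (_/_; _%_; m≡m%n+[m/n]*n; m%n<n; m/n*n≤m)
import Data.Nat.Properties as ℕ
open import Data.Bool using (Bool; true; false; not; if_then_else_; _∧_)
open import Data.Fin as F using (Fin; zero; suc; inject₁; fromℕ; toℕ; _≟_)
import Data.Fin.Properties as F
open import Data.Fin.Relation.Unary.Top using (view; ‵fromℕ; ‵inject₁)
open import Data.Product using (Σ; ∃; ∃₂; _×_; _,_; proj₁; proj₂)
open import Data.Sum using (_⊎_; inj₁; inj₂)
open import Data.List using (List; []; _∷_; [_]; _++_; length; lookup; map; concat; concatMap; allFin; tabulate; filter; cartesianProduct; applyUpTo)
open import Data.List.Properties using (map-tabulate; map-++; map-∘; ++-assoc; concatMap-++; ++-identityʳ; length-tabulate; length-++; length-applyUpTo; ∷-injective; ∷-injectiveˡ; ∷-injectiveʳ)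
open import Data.List.Membership.Propositional using (_∈_)
open import Data.List.Membership.Propositional.Properties
open import Data.List.Relation.Binary.Permutation.Propositional using (_↭_; prep; swap; ↭-refl; ↭-sym; ↭-trans; ↭-reflexive; module PermutationReasoning)
open import Data.List.Relation.Binary.Permutation.Propositional.Properties using (↭-length; ↭-map-inv; ∈-resp-↭; All-resp-↭; drop-∷; shift; shifts; map⁺; ++⁺; ++⁺ˡ; ++⁺ʳ) renaming (++-comm to ++-comm-↭)
open import Data.List.Relation.Unary.All as All using (All; []; _∷_)
import Data.List.Relation.Unary.All.Properties as All
open import Data.List.Relation.Unary.AllPairs as AllPairs using (AllPairs; []; _∷_)
import Data.List.Relation.Unary.AllPairs.Properties as AllPairs
open import Data.List.Relation.Unary.Any as Any using (here; there)
open import Data.List.Relation.Unary.Any.Properties using (lookup-index)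
open import Data.List.Relation.Unary.Unique.Propositional using (Unique)
open import Data.List.Relation.Unary.Unique.Propositional.Properties using (allFin⁺; filter⁺; cartesianProduct⁺)
open import Algebra.Properties.CommutativeMonoid.Sum ℕ.+-0-commutativeMonoid using (sum; sum-cong-≗; sum-replicate-zero; ∑-distrib-+; sum-permute)
open import Function using (_∘_; id; case_of_)
open import Function.Bundles using (_↔_; Inverse; mk↔ₛ′)
open import Function.Definitions using (Injective)
open import Relation.Binary.Definitions using (tri<; tri≈; tri>)
open import Relation.Binary.PropositionalEquality hiding ([_])
open import Relation.Nullary using (¬_; Dec; yes; no; contradiction)
open import Relation.Nullary.Decidable using (⌊_⌋; dec-true; dec-false; isYes≗does; decidable-stable; _→-dec_; _×-dec_)

comp-involutive : ∀ l → comp (comp l) ≡ l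
comp-involutive (a , false) = refl
comp-involutive (a , true) = refl

comp-injective : ∀ {l l′} → comp l ≡ comp l′ → l ≡ l′
comp-injective {l} {l′} eq = trans (sym (comp-involutive l)) (trans (cong comp eq) (comp-involutive l′))

comp-≢ : ∀ l → l ≢ comp l
comp-≢ (a , false) ()
comp-≢ (a , true) ()

concat-tabulate-none : ∀ {A : Set} {n} (f : Fin n → List A) →
                       (∀ j → f j ≡ []) → concat (tabulate f) ≡ []
concat-tabulate-none {n = zero} f none = refl
concat-tabulate-none {n = suc n} f none rewrite none zero = concat-tabulate-none (f ∘ suc) (none ∘ suc)

concat-tabulate-single : ∀ {A : Set} {n} (f : Fin n → List A) i →
                         (∀ j → j ≢ i → f j ≡ []) → concat (tabulate f) ≡ f i
concat-tabulate-single f zero others =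
  trans (cong (f zero ++_) (concat-tabulate-none (f ∘ suc) (λ j → others (suc j) λ ())))
        (++-identityʳ (f zero))
concat-tabulate-single f (suc i) others rewrite others zero (λ ()) =
  concat-tabulate-single (f ∘ suc) i (λ j j≢i → others (suc j) (j≢i ∘ F.suc-injective))

concatMap-tabulate : ∀ {A B : Set} {n} (f : A → List B) (g : Fin n → A) →
                     concatMap f (tabulate g) ≡ concat (tabulate (f ∘ g))
concatMap-tabulate f g = cong concat (map-tabulate g f)

-- Labelled edges

LEdge : ℕ → Set
LEdge n = (Fin n × Fin n) × Label

module _ {n : ℕ} where

  firstEnd secondEnd : Fin n → LEdge n → List Label
  firstEnd v ((u , w) , l) = if ⌊ u ≟ v ⌋ then [ l ] else []
  secondEnd v ((u , w) , l) = if ⌊ w ≟ v ⌋ then [ comp l ] else []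

  ends : Fin n → List (LEdge n) → List Label
  ends v = concatMap (λ e → firstEnd v e ++ secondEnd v e)

  ends-split : ∀ v L → ends v L ↭ concatMap (firstEnd v) L ++ concatMap (secondEnd v) L
  ends-split v [] = ↭-refl
  ends-split v (e ∷ L) = begin
    (a ++ b) ++ ends v L   ↭⟨ ++⁺ˡ (a ++ b) (ends-split v L) ⟩
    (a ++ b) ++ as ++ bs   ≡⟨ ++-assoc a b (as ++ bs) ⟩
    a ++ b ++ as ++ bs     ↭⟨ ++⁺ˡ a (shifts b as) ⟩
    a ++ as ++ b ++ bs     ≡⟨ ++-assoc a as (b ++ bs) ⟨
    (a ++ as) ++ b ++ bs   ∎
    where
    open PermutationReasoning
    a = firstEnd v e
    b = secondEnd v e
    as = concatMap (firstEnd v) L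
    bs = concatMap (secondEnd v) L

  ends-↭ : ∀ v {L L′} → L ↭ L′ → ends v L ↭ ends v L′
  ends-↭ v _↭_.refl = ↭-refl
  ends-↭ v (prep e p) = ++⁺ˡ (firstEnd v e ++ secondEnd v e) (ends-↭ v p)
  ends-↭ v (swap e e′ p) =
    ↭-trans (shifts (firstEnd v e ++ secondEnd v e) (firstEnd v e′ ++ secondEnd v e′))
            (++⁺ˡ (firstEnd v e′ ++ secondEnd v e′) (++⁺ˡ (firstEnd v e ++ secondEnd v e) (ends-↭ v p)))
  ends-↭ v (_↭_.trans p q) = ↭-trans (ends-↭ v p) (ends-↭ v q)

  attach : (es : List (Fin n × Fin n)) → (Fin (length es) → Label) → List (LEdge n)
  attach [] lab = []
  attach (e ∷ es) lab = (e , lab zero) ∷ attach es (lab ∘ suc)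

  map-attach : ∀ es lab → map proj₁ (attach es lab) ≡ es
  map-attach [] lab = refl
  map-attach (e ∷ es) lab = cong (e ∷_) (map-attach es (lab ∘ suc))

  labels : (L : List (LEdge n)) → Fin (length (map proj₁ L)) → Label
  labels (e ∷ L) zero = proj₂ e
  labels (e ∷ L) (suc k) = labels L k

  attach-labels : ∀ L → attach (map proj₁ L) (labels L) ≡ L
  attach-labels [] = refl
  attach-labels (e ∷ L) = cong (e ∷_) (attach-labels L)

  endLabels-attach : ∀ es lab v →
    endLabels (record { order = n ; edges = es }) lab v ≡ ends v (attach es lab)
  endLabels-attach es lab v = trans (concatMap-tabulate
      (λ k → firstEnd v (lookup es k , lab k) ++ secondEnd v (lookup es k , lab k)) id) (go es lab)
    where
    go : ∀ es lab →
         concat (tabulate (λ k → firstEnd v (lookup es k , lab k) ++ secondEnd v (lookup es k , lab k)))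
         ≡ ends v (attach es lab)
    go [] lab = refl
    go (e ∷ es) lab = cong ((firstEnd v (e , lab zero) ++ secondEnd v (e , lab zero)) ++_) (go es (lab ∘ suc))

  firstEnd-hit : ∀ u w l → firstEnd u ((u , w) , l) ≡ [ l ]
  firstEnd-hit u w l rewrite isYes≗does (u ≟ u) | dec-true (u ≟ u) refl = refl

  firstEnd-miss : ∀ {u v} w l → u ≢ v → firstEnd v ((u , w) , l) ≡ []
  firstEnd-miss {u} {v} w l u≢v rewrite isYes≗does (u ≟ v) | dec-false (u ≟ v) u≢v = refl

  secondEnd-hit : ∀ u w l → secondEnd w ((u , w) , l) ≡ [ comp l ]
  secondEnd-hit u w l rewrite isYes≗does (w ≟ w) | dec-true (w ≟ w) refl = refl

  secondEnd-miss : ∀ {w v} u l → w ≢ v → secondEnd v ((u , w) , l) ≡ []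
  secondEnd-miss {w} {v} u l w≢v rewrite isYes≗does (w ≟ v) | dec-false (w ≟ v) w≢v = refl

graph : ∀ {n} → List (LEdge n) → Graph
graph {n} L = record { order = n ; edges = map proj₁ L }

endLabels-graph : ∀ {n} (L : List (LEdge n)) v → endLabels (graph L) (labels L) v ≡ ends v L
endLabels-graph L v =
  trans (endLabels-attach (map proj₁ L) (labels L) v) (cong (ends v) (attach-labels L))

realizes-graph : ∀ {n} (P : Pot) (L : List (LEdge n)) (τ : Fin n → Fin (length P)) →
                 (∀ v → ends v L ↭ lookup P (τ v)) → Realizes P (graph L)
realizes-graph P L τ fits = τ , labels L , λ v →
  ↭-trans (↭-reflexive (endLabels-graph L v)) (fits v)

-- The wheel

prev : ∀ {k} → Fin (suc k) → Fin (suc k)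
prev {k} zero = fromℕ k
prev (suc i) = inject₁ i

next : ∀ {k} → Fin (suc k) → Fin (suc k)
next i with view i
... | ‵fromℕ = zero
... | ‵inject₁ j = suc j

prev-next : ∀ {k} (i : Fin (suc k)) → prev (next i) ≡ i
prev-next i with view i
... | ‵fromℕ = refl
... | ‵inject₁ j = refl

prev-injective : ∀ {k} {i j : Fin (suc k)} → prev i ≡ prev j → i ≡ j
prev-injective {i = zero} {zero} eq = refl
prev-injective {i = zero} {suc j} eq = contradiction eq F.fromℕ≢inject₁
prev-injective {i = suc i} {zero} eq = contradiction (sym eq) F.fromℕ≢inject₁
prev-injective {i = suc i} {suc j} eq = cong suc (F.inject₁-injective eq)

next-prev : ∀ {k} (i : Fin (suc k)) → next (prev i) ≡ i
next-prev i = prev-injective (prev-next (prev i))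

next-injective : ∀ {k} {i j : Fin (suc k)} → next i ≡ next j → i ≡ j
next-injective {i = i} {j} eq = trans (sym (prev-next i)) (trans (cong prev eq) (prev-next j))

prev²≢id : ∀ {k} → 2 ≤ k → (i : Fin (suc k)) → prev (prev i) ≢ i
prev²≢id {suc zero} (s≤s ())
prev²≢id {suc (suc k)} _ zero ()
prev²≢id {suc (suc k)} _ (suc zero) ()
prev²≢id {suc (suc k)} _ (suc (suc i)) eq =
  ℕ.<⇒≢ (ℕ.m<n⇒m<1+n (ℕ.n<1+n (toℕ i)))
        (trans (sym (trans (F.toℕ-inject₁ (inject₁ i)) (F.toℕ-inject₁ i))) (cong toℕ eq))

module _ {k : ℕ} where

  rim spoke : Fin (suc k) → Fin (suc (suc k)) × Fin (suc (suc k))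
  rim h = suc (prev h) , suc h
  spoke j = zero , suc j

  module _ (q s : Fin (suc k) → Label) where

    rimL spokeL : Fin (suc k) → LEdge (suc (suc k))
    rimL h = rim h , q h
    spokeL j = spoke j , s j

    -- The order of the edges agrees with the one in `wheel`.
    wheelL : List (LEdge (suc (suc k)))
    wheelL = map (rimL ∘ suc) (allFin k) ++ rimL zero ∷ map spokeL (allFin (suc k))

    rims++spokes : List (LEdge (suc (suc k)))
    rims++spokes = map rimL (allFin (suc k)) ++ map spokeL (allFin (suc k))

    edges-wheelL : map proj₁ wheelL ≡ edges (wheel (suc (suc k)))
    edges-wheelL = trans (map-++ proj₁ (map (rimL ∘ suc) (allFin k)) _)
      (cong₂ (λ xs ys → xs ++ rim zero ∷ ys) (sym (map-∘ (allFin k))) (sym (map-∘ (allFin (suc k)))))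

    wheelL-↭ : wheelL ↭ rims++spokes
    wheelL-↭ = ↭-trans (shift (rimL zero) (map (rimL ∘ suc) (allFin k)) _)
      (↭-reflexive (cong (λ xs → rimL zero ∷ xs ++ map spokeL (allFin (suc k)))
        (trans (map-tabulate id (rimL ∘ suc)) (sym (map-tabulate suc rimL)))))

    private
      ends-first : ∀ v → concatMap (firstEnd v) rims++spokes
                   ≡ concat (tabulate (firstEnd v ∘ rimL)) ++ concat (tabulate (firstEnd v ∘ spokeL))
      ends-first v = trans (concatMap-++ (firstEnd v) (map rimL (allFin (suc k))) _)
        (cong₂ _++_ (trans (cong (concatMap (firstEnd v)) (map-tabulate id rimL)) (concatMap-tabulate (firstEnd v) rimL))
                    (trans (cong (concatMap (firstEnd v)) (map-tabulate id spokeL)) (concatMap-tabulate (firstEnd v) spokeL)))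

      ends-second : ∀ v → concatMap (secondEnd v) rims++spokes
                    ≡ concat (tabulate (secondEnd v ∘ rimL)) ++ concat (tabulate (secondEnd v ∘ spokeL))
      ends-second v = trans (concatMap-++ (secondEnd v) (map rimL (allFin (suc k))) _)
        (cong₂ _++_ (trans (cong (concatMap (secondEnd v)) (map-tabulate id rimL)) (concatMap-tabulate (secondEnd v) rimL))
                    (trans (cong (concatMap (secondEnd v)) (map-tabulate id spokeL)) (concatMap-tabulate (secondEnd v) spokeL)))

      concat-[-] : ∀ {A : Set} {n} (f : Fin n → A) → concat (tabulate (λ i → [ f i ])) ≡ tabulate f
      concat-[-] {n = zero} f = refl
      concat-[-] {n = suc n} f = cong (f zero ∷_) (concat-[-] (f ∘ suc))

    ends-hub : ends zero wheelL ↭ tabulate s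
    ends-hub = begin
      ends zero wheelL  ↭⟨ ends-↭ zero {wheelL} {rims++spokes} wheelL-↭ ⟩
      ends zero rims++spokes       ↭⟨ ends-split zero rims++spokes ⟩
      _                 ≡⟨ cong₂ _++_ (ends-first zero) (ends-second zero) ⟩
      (concat (tabulate (firstEnd zero ∘ rimL)) ++ concat (tabulate (firstEnd zero ∘ spokeL)))
        ++ concat (tabulate (secondEnd zero ∘ rimL)) ++ concat (tabulate (secondEnd zero ∘ spokeL))
                        ≡⟨ cong₂ _++_
                             (cong₂ _++_ (concat-tabulate-none (firstEnd zero ∘ rimL) (λ _ → refl)) (concat-[-] s))
                             (cong₂ _++_ (concat-tabulate-none (secondEnd zero ∘ rimL) (λ _ → refl))
                                         (concat-tabulate-none (secondEnd zero ∘ spokeL) (λ _ → refl))) ⟩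
      tabulate s ++ []  ≡⟨ ++-identityʳ (tabulate s) ⟩
      tabulate s        ∎
      where open PermutationReasoning

    ends-rim : ∀ j → ends (suc j) wheelL ↭ q (next j) ∷ comp (q j) ∷ comp (s j) ∷ []
    ends-rim j = begin
      ends (suc j) wheelL  ↭⟨ ends-↭ (suc j) {wheelL} {rims++spokes} wheelL-↭ ⟩
      ends (suc j) rims++spokes       ↭⟨ ends-split (suc j) rims++spokes ⟩
      _                    ≡⟨ cong₂ _++_ (ends-first (suc j)) (ends-second (suc j)) ⟩
      (concat (tabulate (firstEnd (suc j) ∘ rimL)) ++ concat (tabulate (firstEnd (suc j) ∘ spokeL)))
        ++ concat (tabulate (secondEnd (suc j) ∘ rimL)) ++ concat (tabulate (secondEnd (suc j) ∘ spokeL))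
                           ≡⟨ cong₂ _++_
                                (cong₂ _++_ out (concat-tabulate-none (firstEnd (suc j) ∘ spokeL) (λ _ → refl)))
                                (cong₂ _++_ in′ sp) ⟩
      q (next j) ∷ comp (q j) ∷ comp (s j) ∷ [] ∎
      where
      open PermutationReasoning
      out : concat (tabulate (firstEnd (suc j) ∘ rimL)) ≡ [ q (next j) ]
      out = trans (concat-tabulate-single (firstEnd (suc j) ∘ rimL) (next j)
                    (λ h h≢ → firstEnd-miss (suc h) (q h) (λ eq → h≢
                      (trans (sym (next-prev h)) (cong next (F.suc-injective eq))))))
                  (subst (λ v → firstEnd (suc j) ((suc v , suc (next j)) , q (next j)) ≡ [ q (next j) ])
                         (sym (prev-next j)) (firstEnd-hit (suc j) (suc (next j)) (q (next j))))
      in′ : concat (tabulate (secondEnd (suc j) ∘ rimL)) ≡ [ comp (q j) ]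
      in′ = trans (concat-tabulate-single (secondEnd (suc j) ∘ rimL) j
                    (λ h h≢ → secondEnd-miss (suc (prev h)) (q h) (h≢ ∘ F.suc-injective)))
                  (secondEnd-hit (suc (prev j)) (suc j) (q j))
      sp : concat (tabulate (secondEnd (suc j) ∘ spokeL)) ≡ [ comp (s j) ]
      sp = trans (concat-tabulate-single (secondEnd (suc j) ∘ spokeL) j
                    (λ h h≢ → secondEnd-miss zero (s h) (h≢ ∘ F.suc-injective)))
                  (secondEnd-hit zero (suc j) (s j))

SameEnds-sym : ∀ {n} {e e′ : Fin n × Fin n} → SameEnds e e′ → SameEnds e′ e
SameEnds-sym (inj₁ (p , q)) = inj₁ (sym p , sym q)
SameEnds-sym (inj₂ (p , q)) = inj₂ (sym q , sym p)

allPairs-lookup : ∀ {A : Set} {R : A → A → Set} → (∀ {x y} → R x y → R y x) →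
                  ∀ {xs} → AllPairs R xs → ∀ i j → i ≢ j → R (lookup xs i) (lookup xs j)
allPairs-lookup R-sym (px ∷ pxs) zero zero i≢j = contradiction refl i≢j
allPairs-lookup R-sym {x ∷ xs} (px ∷ pxs) zero (suc j) i≢j = All.lookup px (∈-lookup {xs = xs} j)
allPairs-lookup R-sym {x ∷ xs} (px ∷ pxs) (suc i) zero i≢j = R-sym (All.lookup px (∈-lookup {xs = xs} i))
allPairs-lookup R-sym (px ∷ pxs) (suc i) (suc j) i≢j = allPairs-lookup R-sym pxs i j (i≢j ∘ cong suc)

rim-simple : ∀ {k} → 2 ≤ k → {h h′ : Fin (suc k)} → SameEnds (rim h) (rim h′) → h ≡ h′
rim-simple 2≤k (inj₁ (_ , eq)) = F.suc-injective eq
rim-simple 2≤k {h} {h′} (inj₂ (eq , eq′)) =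
  contradiction (trans (cong prev (F.suc-injective eq)) (sym (F.suc-injective eq′))) (prev²≢id 2≤k h)

wheel-simple : ∀ {k} → 2 ≤ k → ∀ a b →
  SameEnds (lookup (edges (wheel (suc (suc k)))) a) (lookup (edges (wheel (suc (suc k)))) b) → a ≡ b
wheel-simple {k} 2≤k a b same = decidable-stable (a ≟ b) λ a≢b →
  allPairs-lookup (_∘ SameEnds-sym) allPairs a b a≢b same
  where
  Distinct : (e e′ : Fin (suc (suc k)) × Fin (suc (suc k))) → Set
  Distinct e e′ = ¬ SameEnds e e′

  rim-spoke : ∀ h j → Distinct (rim h) (spoke j)
  rim-spoke h j (inj₁ (() , _))
  rim-spoke h j (inj₂ (_ , ()))

  spoke-spoke : ∀ {i j : Fin (suc k)} → i ≢ j → Distinct (spoke i) (spoke j)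
  spoke-spoke i≢j (inj₁ (_ , refl)) = i≢j refl

  to-spokes : ∀ h → All (Distinct (rim h)) (map spoke (allFin (suc k)))
  to-spokes h = All.map⁺ (All.tabulate⁺ (rim-spoke h))

  allPairs : AllPairs Distinct (edges (wheel (suc (suc k))))
  allPairs = AllPairs.++⁺
    (AllPairs.map⁺ (AllPairs.tabulate⁺ λ i≢j same → i≢j (F.suc-injective (rim-simple 2≤k same))))
    (to-spokes zero ∷ AllPairs.map⁺ (AllPairs.tabulate⁺ spoke-spoke))
    (All.map⁺ (All.tabulate⁺ λ i → (λ same → F.0≢1+n (sym (rim-simple 2≤k {suc i} {zero} same))) ∷ to-spokes (suc i)))

map-++-split : ∀ {A B : Set} (f : A → B) L xs {ys} → map f L ≡ xs ++ ys →
               ∃₂ λ L₁ L₂ → L ≡ L₁ ++ L₂ × map f L₁ ≡ xs × map f L₂ ≡ ys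
map-++-split f L [] eq = [] , L , refl , refl , eq
map-++-split f (e ∷ L) (x ∷ xs) eq with map-++-split f L xs (∷-injectiveʳ eq)
... | L₁ , L₂ , refl , eq₁ , eq₂ = e ∷ L₁ , L₂ , refl , cong₂ _∷_ (∷-injectiveˡ eq) eq₁ , eq₂

map-proj₁-tabulate : ∀ {A B : Set} {m} (g : Fin m → A) (L : List (A × B)) → map proj₁ L ≡ tabulate g →
                     Σ (Fin m → B) λ r → L ≡ tabulate (λ i → g i , r i)
map-proj₁-tabulate {m = zero} g [] eq = (λ ()) , refl
map-proj₁-tabulate {m = suc m} g ((x , l) ∷ L) eq with ∷-injective eq
... | refl , eq′ with map-proj₁-tabulate (g ∘ suc) L eq′
... | r , refl = (λ { zero → l ; (suc i) → r i }) , refl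

wheelL-surjective : ∀ {k} (L : List (LEdge (suc (suc k)))) → map proj₁ L ≡ edges (wheel (suc (suc k))) →
                    ∃₂ λ q s → L ≡ wheelL q s
wheelL-surjective {k} L eq
  with map-++-split proj₁ L (map (rim ∘ suc) (allFin k)) eq
... | L₁ , (_ , l) ∷ L₂ , refl , eq₁ , eq₂ with ∷-injective eq₂
... | refl , eq₂′
  with map-proj₁-tabulate (rim ∘ suc) L₁ (trans eq₁ (map-tabulate id (rim ∘ suc)))
     | map-proj₁-tabulate spoke L₂ (trans eq₂′ (map-tabulate id spoke))
... | r , refl | s , refl = q , s ,
  cong₂ (λ xs ys → xs ++ rimL q s zero ∷ ys) (sym (map-tabulate id (rimL q s ∘ suc))) (sym (map-tabulate id (spokeL q s)))
  where
  q : Fin (suc k) → Label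
  q zero = l
  q (suc i) = r i

extract : ∀ {A : Set} {x : A} {xs} → Unique xs → x ∈ xs → ∃ λ ys → xs ↭ x ∷ ys × Unique (x ∷ ys)
extract {xs = _ ∷ xs} u (here refl) = xs , ↭-refl , u
extract {x = x} {y ∷ xs} (px ∷ u) (there x∈) with extract u x∈
... | ys , p , (x≢ys ∷ uys) with All-resp-↭ p px
... | y≢x ∷ y≢ys = y ∷ ys , ↭-trans (prep y p) (swap y x ↭-refl) , ((y≢x ∘ sym) ∷ x≢ys) ∷ y≢ys ∷ uys

SameEnds-trans : ∀ {n} {e f g : Fin n × Fin n} → SameEnds e f → SameEnds f g → SameEnds e g
SameEnds-trans (inj₁ (refl , refl)) fg = fg
SameEnds-trans (inj₂ (refl , refl)) (inj₁ (refl , refl)) = inj₂ (refl , refl)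
SameEnds-trans (inj₂ (refl , refl)) (inj₂ (refl , refl)) = inj₁ (refl , refl)

module _ {n : ℕ} (v : Fin n) where

  ends-swap : ∀ (u w u′ w′ : Fin n) l R →
              ends v (((u , w) , l) ∷ ((u′ , w′) , l) ∷ R) ↭ ends v (((u , w′) , l) ∷ ((u′ , w) , l) ∷ R)
  ends-swap u w u′ w′ l R = begin
    (a ++ b) ++ (a′ ++ b′) ++ r  ↭⟨ ++⁺ʳ _ (++-comm-↭ a b) ⟩
    (b ++ a) ++ (a′ ++ b′) ++ r  ≡⟨ ++-assoc b a _ ⟩
    b ++ a ++ (a′ ++ b′) ++ r    ↭⟨ ++⁺ˡ b (++⁺ˡ a (++⁺ʳ r (++-comm-↭ a′ b′))) ⟩
    b ++ a ++ (b′ ++ a′) ++ r    ≡⟨ cong (λ z → b ++ a ++ z) (++-assoc b′ a′ r) ⟩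
    b ++ a ++ b′ ++ a′ ++ r      ≡⟨ cong (b ++_) (++-assoc a b′ (a′ ++ r)) ⟨
    b ++ (a ++ b′) ++ a′ ++ r    ↭⟨ shifts b (a ++ b′) ⟩
    (a ++ b′) ++ b ++ a′ ++ r    ≡⟨ cong ((a ++ b′) ++_) (++-assoc b a′ r) ⟨
    (a ++ b′) ++ (b ++ a′) ++ r  ↭⟨ ++⁺ˡ (a ++ b′) (++⁺ʳ r (++-comm-↭ b a′)) ⟩
    (a ++ b′) ++ (a′ ++ b) ++ r  ∎
    where
    open PermutationReasoning
    a = firstEnd v ((u , w) , l)
    b = secondEnd v ((u , w) , l)
    a′ = firstEnd v ((u′ , w′) , l)
    b′ = secondEnd v ((u′ , w′) , l)
    r = ends v R

  ends-flip : ∀ (u w : Fin n) l R → ends v (((u , w) , l) ∷ R) ↭ ends v (((w , u) , comp l) ∷ R)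
  ends-flip u w l R = ++⁺ʳ (ends v R)
    (↭-trans (++-comm-↭ (firstEnd v ((u , w) , l)) (secondEnd v ((u , w) , l)))
             (↭-reflexive (cong (λ l′ → secondEnd v ((u , w) , l) ++ (if ⌊ u ≟ v ⌋ then [ l′ ] else []))
                                (sym (comp-involutive l)))))

module _ {k : ℕ} where

  private
    W : Graph
    W = wheel (suc (suc k))

  rim∈wheel : ∀ h → rim h ∈ edges W
  rim∈wheel zero = ∈-++⁺ʳ _ (here refl)
  rim∈wheel (suc i) = ∈-++⁺ˡ (∈-map⁺ _ (∈-allFin i))

  spoke∈wheel : ∀ j → spoke j ∈ edges W
  spoke∈wheel j = ∈-++⁺ʳ (map (rim ∘ suc) (allFin k)) (there (∈-map⁺ _ (∈-allFin j)))

  wheel-no-cut-vertex : ∀ {A : Set} (colour : Fin (suc (suc k)) → A) z →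
    (∀ {u w} → (u , w) ∈ edges W → u ≢ z → w ≢ z → colour u ≡ colour w) →
    ∀ {x y} → x ≢ z → y ≢ z → colour x ≡ colour y
  wheel-no-cut-vertex colour zero same {x} {y} x≢z y≢z = trans (base x x≢z) (sym (base y y≢z))
    where
    along : ∀ {m} (f : Fin (suc m) → _) → (∀ i → f (inject₁ i) ≡ f (suc i)) → ∀ i → f i ≡ f zero
    along f step zero = refl
    along {suc m} f step (suc i) = trans (along (f ∘ suc) (step ∘ suc) i) (sym (step zero))

    base : ∀ x → x ≢ zero → colour x ≡ colour (suc zero)
    base zero x≢z = contradiction refl x≢z
    base (suc i) _ = along (colour ∘ suc) (λ i → same (rim∈wheel (suc i)) (λ ()) (λ ())) i
  wheel-no-cut-vertex colour (suc z) same {x} {y} x≢z y≢z = trans (base x x≢z) (sym (base y y≢z))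
    where
    base : ∀ x → x ≢ suc z → colour x ≡ colour zero
    base zero _ = refl
    base (suc i) x≢z = sym (same (spoke∈wheel i) (λ ()) x≢z)

  no-cut-vertex : ∀ {A : Set} {H} → Iso H W → (colour : Fin (order H) → A) → ∀ z →
    (∀ {u w} → (u , w) ∈ edges H → u ≢ z → w ≢ z → colour u ≡ colour w) →
    ∀ {x y} → x ≢ z → y ≢ z → colour x ≡ colour y
  no-cut-vertex {H = H} (σ , π , matches) colour z same {x} {y} x≢z y≢z =
    subst₂ (λ u w → colour u ≡ colour w) (from-to x) (from-to y)
      (wheel-no-cut-vertex (colour ∘ from) (to z) same′ (x≢z ∘ to-inj) (y≢z ∘ to-inj))
    where
    open Inverse σ using (to; from)
    from-to : ∀ u → from (to u) ≡ u
    from-to u = Inverse.strictlyInverseʳ σ u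
    to-from : ∀ u → to (from u) ≡ u
    to-from u = Inverse.strictlyInverseˡ σ u
    to-inj : ∀ {u w} → to u ≡ to w → u ≡ w
    to-inj {u} {w} eq = trans (sym (from-to u)) (trans (cong from eq) (from-to w))

    from-edge : ∀ e → e ∈ edges W →
      ∃₂ λ u w → (u , w) ∈ edges H × SameEnds (u , w) (from (proj₁ e) , from (proj₂ e))
    from-edge e e∈ with matches (Inverse.from π (Any.index e∈))
    ... | m rewrite Inverse.strictlyInverseˡ π (Any.index e∈) | sym (lookup-index e∈) =
      _ , _ , ∈-lookup (Inverse.from π (Any.index e∈)) , pull m
      where
      pull : ∀ {u w a b} → SameEnds (to u , to w) (a , b) → SameEnds (u , w) (from a , from b)
      pull (inj₁ (refl , refl)) = inj₁ (sym (from-to _) , sym (from-to _))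
      pull (inj₂ (refl , refl)) = inj₂ (sym (from-to _) , sym (from-to _))

    away : ∀ {a} → a ≢ to z → from a ≢ z
    away a≢ eq = a≢ (trans (sym (to-from _)) (cong to eq))

    same′ : ∀ {u w} → (u , w) ∈ edges W → u ≢ to z → w ≢ to z → colour (from u) ≡ colour (from w)
    same′ {u} {w} e∈ u≢ w≢ with from-edge (u , w) e∈
    ... | _ , _ , e′∈ , inj₁ (refl , refl) = same e′∈ (away u≢) (away w≢)
    ... | _ , _ , e′∈ , inj₂ (refl , refl) = sym (same e′∈ (away w≢) (away u≢))

  no-double-edge : 2 ≤ k → ∀ {H} → Iso H W → ∀ a b → lookup (edges H) a ≡ lookup (edges H) b → a ≡ b
  no-double-edge 2≤k {H} (σ , π , matches) a b eq =
    trans (sym (Inverse.strictlyInverseʳ π a)) (trans (cong (Inverse.from π) πa≡πb) (Inverse.strictlyInverseʳ π b))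
    where
    same : SameEnds (lookup (edges W) (Inverse.to π a)) (lookup (edges W) (Inverse.to π b))
    same = SameEnds-trans (SameEnds-sym (matches a))
      (subst (λ e → SameEnds (Inverse.to σ (proj₁ e) , Inverse.to σ (proj₂ e)) (lookup (edges W) (Inverse.to π b)))
             (sym eq) (matches b))
    πa≡πb : Inverse.to π a ≡ Inverse.to π b
    πa≡πb = wheel-simple 2≤k _ _ same

between : ℕ → ℕ → ℕ → Bool
between a b x = ⌊ a ℕ.≤? x ⌋ ∧ ⌊ x ℕ.<? b ⌋

between-yes : ∀ {a b x} → a ≤ x → x < b → between a b x ≡ true
between-yes {a} {b} {x} a≤x x<b with a ℕ.≤? x | x ℕ.<? b
... | yes _ | yes _ = refl
... | no a≰x | _ = contradiction a≤x a≰x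
... | yes _ | no x≮b = contradiction x<b x≮b

between-below : ∀ {a b x} → x < a → between a b x ≡ false
between-below {a} {b} {x} x<a with a ℕ.≤? x
... | yes a≤x = contradiction a≤x (ℕ.<⇒≱ x<a)
... | no _ = refl

between-above : ∀ {a b x} → b ≤ x → between a b x ≡ false
between-above {a} {b} {x} b≤x with a ℕ.≤? x | x ℕ.<? b
... | _ | yes x<b = contradiction x<b (ℕ.≤⇒≯ b≤x)
... | yes _ | no _ = refl
... | no _ | no _ = refl

between-suc : ∀ {a b x} → suc x ≢ a → suc x ≢ b → between a b x ≡ between a b (suc x)
between-suc {a} {b} {x} ≢a ≢b = cong₂ _∧_ lower upper
  where
  lower : ⌊ a ℕ.≤? x ⌋ ≡ ⌊ a ℕ.≤? suc x ⌋
  lower with a ℕ.≤? x | a ℕ.≤? suc x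
  ... | yes _ | yes _ = refl
  ... | no _ | no _ = refl
  ... | yes a≤x | no a≰ = contradiction (ℕ.m≤n⇒m≤1+n a≤x) a≰
  ... | no a≰x | yes a≤ = contradiction (ℕ.≤-antisym (ℕ.≰⇒> a≰x) a≤) ≢a
  upper : ⌊ x ℕ.<? b ⌋ ≡ ⌊ suc x ℕ.<? b ⌋
  upper with x ℕ.<? b | suc x ℕ.<? b
  ... | yes _ | yes _ = refl
  ... | no _ | no _ = refl
  ... | no x≮b | yes x<b = contradiction (ℕ.<-trans (ℕ.n<1+n x) x<b) x≮b
  ... | yes x<b | no x≮b = contradiction (ℕ.≤-antisym x<b (ℕ.≮⇒≥ x≮b)) ≢b

module Rigid {k : ℕ} (2≤k : 2 ≤ k) (q s : Fin (suc k) → Label)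
  (rigid : ∀ L → (∀ v → ends v (wheelL q s) ↭ ends v L) → Iso (graph L) (wheel (suc (suc k)))) where

  private
    rotate : ∀ {A : Set} (x : A) xs y ys → (x ∷ xs) ++ y ∷ ys ↭ x ∷ y ∷ xs ++ ys
    rotate x xs y ys = prep x (shift y xs ys)

    -- Exchanging the heads of two equally labelled rim edges that run in the
    -- same direction splits the rim into two cycles, so the hub becomes a cut vertex.
    no-repeat-< : ∀ {h h′} → h F.< h′ → q h ≢ q h′
    no-repeat-< {h} {h′} h<h′ qh≡qh′
      with extract (allFin⁺ (suc k)) (∈-allFin h)
    ... | ys , p , (h≢ys ∷ uys) with extract uys h′∈ys
      where
      h′∈ys : h′ ∈ ys
      h′∈ys with ∈-resp-↭ p (∈-allFin h′)
      ... | here h′≡h = contradiction (sym h′≡h) (F.<⇒≢ h<h′)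
      ... | there h′∈ = h′∈
    ... | zs , p′ , (h′≢zs ∷ _) = case no-cut-vertex (rigid L′ same) colour zero mono (λ ()) (λ ()) of λ eq →
        case trans (sym colour-h) (trans eq colour-h′) of λ ()
      where
      L″ = map (rimL q s) zs ++ map (spokeL q s) (allFin (suc k))
      L′ : List (LEdge (suc (suc k)))
      L′ = ((suc (prev h) , suc h′) , q h) ∷ ((suc (prev h′) , suc h) , q h) ∷ L″

      perm : wheelL q s ↭ rimL q s h ∷ (rim h′ , q h) ∷ L″
      perm = ↭-trans (wheelL-↭ q s)
        (↭-trans (++⁺ʳ (map (spokeL q s) (allFin (suc k))) (map⁺ (rimL q s) (↭-trans p (prep h p′))))
                 (↭-reflexive (cong (λ l → rimL q s h ∷ (rim h′ , l) ∷ L″) (sym qh≡qh′))))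

      same : ∀ v → ends v (wheelL q s) ↭ ends v L′
      same v = ↭-trans (ends-↭ v {wheelL q s} perm) (ends-swap v (suc (prev h)) (suc h) (suc (prev h′)) (suc h′) (q h) L″)

      a = toℕ h
      b = toℕ h′

      colour : Fin (suc (suc k)) → Bool
      colour zero = false
      colour (suc x) = between a b (toℕ x)

      colour-h : between a b a ≡ true
      colour-h = between-yes ℕ.≤-refl h<h′
      colour-h′ : between a b b ≡ false
      colour-h′ = between-above {a} {b} ℕ.≤-refl

      colour-k : between a b (toℕ (fromℕ k)) ≡ false
      colour-k = between-above {a} {b} (ℕ.≤-trans (ℕ.≤-pred (F.toℕ<n h′)) (ℕ.≤-reflexive (sym (F.toℕ-fromℕ k))))

      before-h : ∀ y → y ≡ h → between a b (toℕ (prev y)) ≡ false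
      before-h zero _ = colour-k
      before-h (suc i) refl = between-below {a} {b}
        (ℕ.≤-reflexive (cong suc (F.toℕ-inject₁ i)))

      before-h′ : ∀ y → y ≡ h′ → between a b (toℕ (prev y)) ≡ true
      before-h′ zero refl = contradiction h<h′ λ ()
      before-h′ (suc i) refl rewrite F.toℕ-inject₁ i = between-yes (ℕ.≤-pred h<h′) (ℕ.n<1+n (toℕ i))

      other : ∀ y → y ≢ h → y ≢ h′ → between a b (toℕ (prev y)) ≡ between a b (toℕ y)
      other zero y≢h _ = trans colour-k (sym (between-below {a} {b} (ℕ.n≢0⇒n>0 λ a≡0 → y≢h (sym (F.toℕ-injective a≡0)))))
      other (suc i) y≢h y≢h′ rewrite F.toℕ-inject₁ i =
        between-suc (y≢h ∘ F.toℕ-injective) (y≢h′ ∘ F.toℕ-injective)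

      zs≢h : ∀ {y} → y ∈ zs → y ≢ h
      zs≢h y∈ refl = All.lookup h≢ys (∈-resp-↭ (↭-sym p′) (there y∈)) refl

      mono : ∀ {u w} → (u , w) ∈ map proj₁ L′ → u ≢ zero → w ≢ zero → colour u ≡ colour w
      mono (here refl) _ _ = trans (before-h h refl) (sym colour-h′)
      mono (there (here refl)) _ _ = trans (before-h′ h′ refl) (sym colour-h)
      mono (there (there e∈)) u≢0 w≢0 with ∈-map⁻ proj₁ e∈
      ... | e , e∈L , refl with ∈-++⁻ (map (rimL q s) zs) e∈L
      ... | inj₁ e∈rims with ∈-map⁻ (rimL q s) e∈rims
      ... | y , y∈ , refl = other y (zs≢h y∈) (λ eq → All.lookup h′≢zs y∈ (sym eq))
      mono (there (there e∈)) u≢0 w≢0 | e , e∈L , refl | inj₂ e∈spokes with ∈-map⁻ (spokeL q s) e∈spokes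
      ... | y , y∈ , refl = contradiction refl u≢0

  q-injective : ∀ {h h′} → q h ≡ q h′ → h ≡ h′
  q-injective {h} {h′} eq with F.<-cmp h h′
  ... | tri< h<h′ _ _ = contradiction eq (no-repeat-< h<h′)
  ... | tri≈ _ h≡h′ _ = h≡h′
  ... | tri> _ _ h′<h = contradiction (sym eq) (no-repeat-< h′<h)

  private
    -- Exchanging heads would join the hub to x twice.
    no-mixed : ∀ h u x j → (∀ v R → ends v (rimL q s h ∷ R) ↭ ends v (((u , suc x) , s j) ∷ R)) → x ≡ j
    no-mixed h u x j present with x ≟ j
    ... | yes x≡j = x≡j
    ... | no x≢j with extract (allFin⁺ (suc k)) (∈-allFin h) | extract (allFin⁺ (suc k)) (∈-allFin j)
    ... | ys , p , _ | zs , p′ , _ =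
      contradiction (no-double-edge 2≤k (rigid L′ same) (suc zero) (suc (suc (Any.index x∈))) (lookup-index x∈)) λ ()
      where
      L″ = map (rimL q s) ys ++ map (spokeL q s) zs
      L′ : List (LEdge (suc (suc k)))
      L′ = ((u , suc j) , s j) ∷ ((zero , suc x) , s j) ∷ L″

      perm : wheelL q s ↭ rimL q s h ∷ spokeL q s j ∷ L″
      perm = ↭-trans (wheelL-↭ q s) (↭-trans (++⁺ (map⁺ (rimL q s) p) (map⁺ (spokeL q s) p′))
        (rotate (rimL q s h) (map (rimL q s) ys) (spokeL q s j) (map (spokeL q s) zs)))

      same : ∀ v → ends v (wheelL q s) ↭ ends v L′
      same v = ↭-trans (ends-↭ v {wheelL q s} perm)
        (↭-trans (present v (spokeL q s j ∷ L″)) (ends-swap v u (suc x) zero (suc j) (s j) L″))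

      x∈zs : x ∈ zs
      x∈zs with ∈-resp-↭ p′ (∈-allFin x)
      ... | here x≡j = contradiction x≡j x≢j
      ... | there x∈ = x∈

      x∈ : spoke x ∈ map proj₁ L″
      x∈ = ∈-map⁺ proj₁ (∈-++⁺ʳ (map (rimL q s) ys) (∈-map⁺ (spokeL q s) x∈zs))

  rim≡spoke⇒head : ∀ {h j} → q h ≡ s j → h ≡ j
  rim≡spoke⇒head {h} {j} eq = no-mixed h (suc (prev h)) h j
    λ v R → ↭-reflexive (cong (λ l → ends v ((rim h , l) ∷ R)) eq)

  rim≡comp-spoke⇒tail : ∀ {h j} → q h ≡ comp (s j) → prev h ≡ j
  rim≡comp-spoke⇒tail {h} {j} eq = no-mixed h (suc h) (prev h) j
    λ v R → ↭-trans (ends-flip v (suc (prev h)) (suc h) (q h) R)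
      (↭-reflexive (cong (λ l → ends v (((suc h , suc (prev h)) , l) ∷ R)) (trans (cong comp eq) (comp-involutive (s j)))))

  same-tile : ∀ {x y} → x ≢ y → ends (suc x) (wheelL q s) ↭ ends (suc y) (wheelL q s) → q (next x) ≡ comp (q y)
  same-tile {x} {y} x≢y same = out≡in
    where
    perm : q (next x) ∷ comp (q x) ∷ comp (s x) ∷ [] ↭ q (next y) ∷ comp (q y) ∷ comp (s y) ∷ []
    perm = ↭-trans (↭-sym (ends-rim q s x)) (↭-trans same (ends-rim q s y))

    sx≡sy : s x ≡ s y
    sx≡sy with ∈-resp-↭ perm (there (there (here refl)))
    ... | here eq = contradiction (trans (sym (rim≡comp-spoke⇒tail (sym eq))) (prev-next y)) x≢y
    ... | there (here eq) = contradiction (sym (rim≡spoke⇒head (sym (comp-injective eq)))) x≢y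
    ... | there (there (here eq)) = comp-injective eq

    toFront : ∀ {A : Set} (a b c : A) → a ∷ b ∷ c ∷ [] ↭ c ∷ a ∷ b ∷ []
    toFront a b c = shift c (a ∷ b ∷ []) []

    perm′ : q (next x) ∷ comp (q x) ∷ [] ↭ q (next y) ∷ comp (q y) ∷ []
    perm′ = drop-∷ (↭-trans (↭-sym (toFront _ _ _))
      (↭-trans perm (↭-trans (toFront _ _ _) (↭-reflexive (cong (λ l → comp l ∷ q (next y) ∷ comp (q y) ∷ []) (sym sx≡sy))))))

    out≡in : q (next x) ≡ comp (q y)
    out≡in with ∈-resp-↭ perm′ (here refl)
    ... | here eq = contradiction (next-injective (q-injective eq)) x≢y
    ... | there (here eq) = eq

-- Walking around the rim

pos : ∀ {k} → ℕ → Fin (suc k)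
pos zero = zero
pos (suc t) = next (pos t)

toℕ-next : ∀ {k} (i : Fin (suc k)) → toℕ i < k → toℕ (next i) ≡ suc (toℕ i)
toℕ-next i i<k with view i
... | ‵fromℕ = contradiction (F.toℕ-fromℕ _) (ℕ.<⇒≢ i<k)
... | ‵inject₁ j = cong suc (sym (F.toℕ-inject₁ j))

toℕ-pos : ∀ {k} t → t ≤ k → toℕ (pos {k} t) ≡ t
toℕ-pos zero _ = refl
toℕ-pos {k} (suc t) t<k = trans (toℕ-next (pos t) (subst (_< k) (sym ih) t<k)) (cong suc ih)
  where ih = toℕ-pos {k} t (ℕ.<⇒≤ t<k)

pos-toℕ : ∀ {k} (i : Fin (suc k)) → pos (toℕ i) ≡ i
pos-toℕ i = F.toℕ-injective (toℕ-pos (toℕ i) (ℕ.≤-pred (F.toℕ<n i)))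

pos-window : ∀ {k} i d → 0 < d → d ≤ k → pos {k} (i + d) ≢ pos i
pos-window {k} zero d 0<d d≤k eq = ℕ.<⇒≢ 0<d (trans (sym (cong toℕ eq)) (toℕ-pos {k} d d≤k))
pos-window (suc i) d 0<d d≤k eq = pos-window i d 0<d d≤k (next-injective eq)

pos-period : ∀ {k} i → pos {k} (i + suc k) ≡ pos i
pos-period {k} zero rewrite F.toℕ-injective {i = pos {k} k} {fromℕ k} (trans (toℕ-pos k ℕ.≤-refl) (sym (F.toℕ-fromℕ k))) =
  next-prev zero
pos-period (suc i) = cong next (pos-period i)

-- Functions with small fibres

module _ {n K : ℕ} (τ : Fin n → Fin K) where

  Lone : Fin n → Set
  Lone x = ∀ y → τ y ≡ τ x → y ≡ x

  lone? : ∀ x → Dec (Lone x)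
  lone? x = F.all? λ y → (τ y ≟ τ x) →-dec (y ≟ x)

  ¬lone⇒twin : ∀ {x} → ¬ Lone x → ∃ λ y → y ≢ x × τ y ≡ τ x
  ¬lone⇒twin {x} ¬lone with F.¬∀⟶∃¬ n _ (λ y → (τ y ≟ τ x) →-dec (y ≟ x)) ¬lone
  ... | y , ¬imp with τ y ≟ τ x
  ... | yes same = y , (λ y≡x → ¬imp λ _ → y≡x) , same
  ... | no differ = contradiction (λ same → contradiction same differ) ¬imp

  fibres-≤2⇒size : (∀ {x y z} → x ≢ y → x ≢ z → τ x ≡ τ y → τ x ≡ τ z → y ≡ z) →
                   ∀ {p} (ℓ : Fin p → Fin n) → Injective _≡_ _≡_ ℓ → (∀ i → Lone (ℓ i)) → n + p ≤ K * 2
  fibres-≤2⇒size atMostTwo {p} ℓ ℓ-injective lone = F.injective⇒≤ {f = f} f-injective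
    where
    Second : Fin n → Set
    Second v = ∃ λ w → w F.< v × τ w ≡ τ v

    second? : ∀ v → Dec (Second v)
    second? v = F.any? λ w → (w F.<? v) ×-dec (τ w ≟ τ v)

    bit : Fin n → Fin 2
    bit v = if ⌊ second? v ⌋ then suc zero else zero

    bit-one : ∀ {v} → bit v ≡ suc zero → Second v
    bit-one {v} eq with second? v
    ... | yes sec = sec
    bit-one {v} () | no _

    one-bit : ∀ {v} → Second v → bit v ≡ suc zero
    one-bit {v} sec with second? v
    ... | yes _ = refl
    ... | no ¬sec = contradiction sec ¬sec

    g : Fin n ⊎ Fin p → Fin K × Fin 2
    g (inj₁ v) = τ v , bit v
    g (inj₂ i) = τ (ℓ i) , suc zero

    no-bit-clash : ∀ {v v′} → v F.< v′ → τ v ≡ τ v′ → bit v ≢ bit v′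
    no-bit-clash {v} {v′} v<v′ same eq with bit-one {v} (trans eq (one-bit {v′} (v , v<v′ , same)))
    ... | w , w<v , same′ = F.<⇒≢ (F.<-trans w<v v<v′)
      (atMostTwo (F.<⇒≢ w<v ∘ sym) (F.<⇒≢ v<v′) (sym same′) same)

    lone-bit : ∀ i → bit (ℓ i) ≢ suc zero
    lone-bit i eq with bit-one {ℓ i} eq
    ... | w , w<v , same = F.<⇒≢ w<v (lone i w same)

    g-injective : ∀ {x y} → g x ≡ g y → x ≡ y
    g-injective {inj₁ v} {inj₁ v′} eq with F.<-cmp v v′
    ... | tri< v<v′ _ _ = contradiction (cong proj₂ eq) (no-bit-clash v<v′ (cong proj₁ eq))
    ... | tri≈ _ v≡v′ _ = cong inj₁ v≡v′
    ... | tri> _ _ v′<v = contradiction (sym (cong proj₂ eq)) (no-bit-clash v′<v (sym (cong proj₁ eq)))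
    g-injective {inj₁ v} {inj₂ i} eq =
      contradiction (subst (λ u → bit u ≡ suc zero) (lone i v (cong proj₁ eq)) (cong proj₂ eq)) (lone-bit i)
    g-injective {inj₂ i} {inj₁ v} eq =
      contradiction (subst (λ u → bit u ≡ suc zero) (lone i v (sym (cong proj₁ eq))) (sym (cong proj₂ eq))) (lone-bit i)
    g-injective {inj₂ i} {inj₂ j} eq = cong inj₂ (ℓ-injective (lone j (ℓ i) (cong proj₁ eq)))

    f : Fin (n + p) → Fin (K * 2)
    f x = F.combine (proj₁ (g (F.splitAt n x))) (proj₂ (g (F.splitAt n x)))

    f-injective : ∀ {x y} → f x ≡ f y → x ≡ y
    f-injective {x} {y} eq with F.combine-injective (proj₁ (g (F.splitAt n x))) (proj₂ (g (F.splitAt n x))) _ _ eq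
    ... | eq₁ , eq₂ = trans (sym (F.join-splitAt n p x))
      (trans (cong (F.join n p) (g-injective {F.splitAt n x} {F.splitAt n y} (cong₂ _,_ eq₁ eq₂))) (F.join-splitAt n p y))

module LowerBound {k : ℕ} (3≤k : 3 ≤ k) (P : Pot) (τ : Fin (suc (suc k)) → Fin (length P))
  (q s : Fin (suc k) → Label)
  (fits : ∀ v → ends v (wheelL q s) ↭ lookup P (τ v))
  (unique : ∀ H → Realizes P H → order H ≡ suc (suc k) → Iso H (wheel (suc (suc k)))) where

  open Rigid (ℕ.<⇒≤ 3≤k) q s
    (λ L same → unique (graph L) (realizes-graph P L τ λ v → ↭-trans (↭-sym (same v)) (fits v)) refl)

  same-ends : ∀ {u v} → τ u ≡ τ v → ends u (wheelL q s) ↭ ends v (wheelL q s)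
  same-ends {u} {v} eq = ↭-trans (fits u) (↭-trans (↭-reflexive (cong (lookup P) eq)) (↭-sym (fits v)))

  hub≢rim : ∀ j → τ zero ≢ τ (suc j)
  hub≢rim j eq = ℕ.<⇒≢ 3≤k (sym (ℕ.suc-injective (trans (sym (length-tabulate s))
    (↭-length (↭-trans (↭-sym (ends-hub q s)) (↭-trans (same-ends eq) (ends-rim q s j)))))))

  twins : ∀ {x y} → x ≢ y → τ (suc x) ≡ τ (suc y) → q (next x) ≡ comp (q y)
  twins x≢y eq = same-tile x≢y (same-ends eq)

  atMostTwo : ∀ {x y z} → x ≢ y → x ≢ z → τ x ≡ τ y → τ x ≡ τ z → y ≡ z
  atMostTwo {zero} {zero} x≢y _ _ _ = contradiction refl x≢y
  atMostTwo {zero} {suc y} _ _ eq _ = contradiction eq (hub≢rim y)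
  atMostTwo {suc x} {zero} _ _ eq _ = contradiction (sym eq) (hub≢rim x)
  atMostTwo {suc x} {suc y} {zero} _ _ _ eq = contradiction (sym eq) (hub≢rim x)
  atMostTwo {suc x} {suc y} {suc z} x≢y x≢z eq eq′ = cong suc (q-injective (comp-injective
    (trans (sym (twins (x≢y ∘ cong suc) eq)) (twins (x≢z ∘ cong suc) eq′))))

  LoneRim : ℕ → Set
  LoneRim t = Lone τ (suc (pos t))

  -- If i and j carry the same tile then so do i + 1 and j − 1, unless i + 1 is lone.
  lone-inside : ∀ d i → d ≤ k → τ (suc (pos i)) ≡ τ (suc (pos (i + d))) → 0 < d →
                ∃ λ t → i < t × t < i + d × LoneRim t
  lone-inside (suc zero) i 1≤k same _ =
    contradiction (trans (twins (pos-window i 1 z<s 1≤k ∘ sym) same)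
                         (cong (comp ∘ q ∘ pos) (ℕ.+-comm i 1)))
                  (comp-≢ (q (pos (suc i))))
  lone-inside (suc (suc d)) i d≤k same _ with lone? τ (suc (pos (suc i)))
  ... | yes lone = suc i , ℕ.n<1+n i , ℕ.≤-trans (s≤s (s≤s (ℕ.m≤m+n i d))) (ℕ.≤-reflexive (sym i+d+2)) , lone
    where
    i+d+2 : i + suc (suc d) ≡ suc (suc (i + d))
    i+d+2 = trans (ℕ.+-suc i (suc d)) (cong suc (ℕ.+-suc i d))
  ... | no ¬lone with ¬lone⇒twin τ ¬lone
  ... | zero , _ , hub = contradiction hub (hub≢rim _)
  ... | suc y , y≢ , twin = recurse d refl
    where
    next-y : next y ≡ pos (i + suc (suc d))
    next-y = q-injective (trans (twins (y≢ ∘ cong suc) twin)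
      (trans (cong comp (twins (pos-window i (suc (suc d)) z<s d≤k ∘ sym) same)) (comp-involutive _)))

    y≡ : y ≡ pos (suc i + d)
    y≡ = next-injective (trans next-y (cong pos (trans (ℕ.+-suc i (suc d)) (cong suc (ℕ.+-suc i d)))))

    recurse : ∀ d′ → d′ ≡ d → ∃ λ t → i < t × t < i + suc (suc d) × LoneRim t
    recurse zero refl = contradiction (trans (cong suc y≡) (cong (suc ∘ pos ∘ suc) (ℕ.+-identityʳ i))) y≢
    recurse (suc d′) refl with lone-inside (suc d′) (suc i) (ℕ.<⇒≤ (ℕ.<⇒≤ d≤k)) (trans (sym twin) (cong (τ ∘ suc) y≡)) z<s
    ... | t , i<t , t<j , lone = t , ℕ.<-trans (ℕ.n<1+n i) i<t ,
      ℕ.<-≤-trans t<j (ℕ.≤-trans (ℕ.n≤1+n _) (ℕ.≤-reflexive (sym (trans (ℕ.+-suc i (suc (suc d′))) (cong suc (ℕ.+-suc i (suc d′))))))) , lone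

  two-lone-from-pair : ∀ {x y : Fin (suc k)} → x F.< y → τ (suc x) ≡ τ (suc y) →
                       ∃₂ λ u v → u ≢ v × Lone τ (suc u) × Lone τ (suc v)
  two-lone-from-pair {x} {y} x<y same
    with lone-inside d i (ℕ.≤-trans (ℕ.m∸n≤m j i) (ℕ.≤-pred (F.toℕ<n y))) same₁ (ℕ.m<n⇒0<n∸m x<y)
       | lone-inside d′ j d′≤k same₂ 0<d′
    where
    i = toℕ x
    j = toℕ y
    d = j ∸ i
    d′ = (i + suc k) ∸ j
    j<i+m : j < i + suc k
    j<i+m = ℕ.<-≤-trans (F.toℕ<n y) (ℕ.m≤n+m (suc k) i)
    0<d′ : 0 < d′
    0<d′ = ℕ.m<n⇒0<n∸m j<i+m
    d′≤k : d′ ≤ k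
    d′≤k = ℕ.m≤n+o⇒m∸n≤o (i + suc k) j (ℕ.≤-trans (ℕ.≤-reflexive (ℕ.+-suc i k)) (ℕ.+-monoˡ-≤ k x<y))
    same₁ : τ (suc (pos i)) ≡ τ (suc (pos (i + d)))
    same₁ = trans (cong (τ ∘ suc) (pos-toℕ x)) (trans same
      (cong (τ ∘ suc) (sym (trans (cong pos (ℕ.m+[n∸m]≡n (ℕ.<⇒≤ x<y))) (pos-toℕ y)))))
    same₂ : τ (suc (pos j)) ≡ τ (suc (pos (j + d′)))
    same₂ = trans (cong (τ ∘ suc) (pos-toℕ y)) (trans (sym same)
      (cong (τ ∘ suc) (sym (trans (cong pos (ℕ.m+[n∸m]≡n (ℕ.<⇒≤ j<i+m))) (trans (pos-period i) (pos-toℕ x))))))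
  ... | t , i<t , t<j , lone | t′ , j<t′ , t′<i+m , lone′ =
    pos t , pos t′ , distinct , lone , lone′
    where
    t<t′ : t < t′
    t<t′ = ℕ.<-trans (ℕ.<-≤-trans t<j (ℕ.≤-reflexive (ℕ.m+[n∸m]≡n (ℕ.<⇒≤ x<y)))) j<t′
    t′∸t≤k : t′ ∸ t ≤ k
    t′∸t≤k = ℕ.m≤n+o⇒m∸n≤o t′ t (ℕ.≤-pred (ℕ.≤-trans
      (ℕ.<-≤-trans t′<i+m (ℕ.≤-reflexive (ℕ.m+[n∸m]≡n (ℕ.<⇒≤ (ℕ.<-≤-trans (F.toℕ<n y) (ℕ.m≤n+m (suc k) (toℕ x)))))))
      (ℕ.≤-trans (ℕ.+-monoˡ-≤ (suc k) (ℕ.<⇒≤ i<t)) (ℕ.≤-reflexive (ℕ.+-suc t k)))))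
    distinct : pos t ≢ pos t′
    distinct eq = pos-window t (t′ ∸ t) (ℕ.m<n⇒0<n∸m t<t′) t′∸t≤k
      (trans (cong pos (ℕ.m+[n∸m]≡n (ℕ.<⇒≤ t<t′))) (sym eq))

  two-lone : ∃₂ λ u v → u ≢ v × Lone τ (suc u) × Lone τ (suc v)
  two-lone with F.all? (λ x → lone? τ (suc x))
  ... | yes all-lone = pos 0 , pos 1 , pos-window 0 1 z<s (ℕ.≤-trans (s≤s z≤n) 3≤k) ∘ sym , all-lone _ , all-lone _
  ... | no ¬all with F.¬∀⟶∃¬ (suc k) _ (λ x → lone? τ (suc x)) ¬all
  ... | x , ¬lone with ¬lone⇒twin τ ¬lone
  ... | zero , _ , hub = contradiction hub (hub≢rim x)
  ... | suc y , y≢x , same with F.<-cmp x y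
  ... | tri< x<y _ _ = two-lone-from-pair x<y (sym same)
  ... | tri≈ _ x≡y _ = contradiction (cong suc (sym x≡y)) y≢x
  ... | tri> _ _ y<x = two-lone-from-pair y<x same

  size : suc (suc k) + 3 ≤ length P * 2
  size with two-lone
  ... | u , v , u≢v , lone-u , lone-v = fibres-≤2⇒size τ atMostTwo ℓ ℓ-injective ℓ-lone
    where
    ℓ : Fin 3 → Fin (suc (suc k))
    ℓ zero = zero
    ℓ (suc zero) = suc u
    ℓ (suc (suc zero)) = suc v

    ℓ-lone : ∀ i → Lone τ (ℓ i)
    ℓ-lone zero zero _ = refl
    ℓ-lone zero (suc j) eq = contradiction (sym eq) (hub≢rim j)
    ℓ-lone (suc zero) = lone-u
    ℓ-lone (suc (suc zero)) = lone-v

    ℓ-injective : Injective _≡_ _≡_ ℓ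
    ℓ-injective {zero} {zero} _ = refl
    ℓ-injective {zero} {suc zero} ()
    ℓ-injective {zero} {suc (suc zero)} ()
    ℓ-injective {suc zero} {zero} ()
    ℓ-injective {suc zero} {suc zero} _ = refl
    ℓ-injective {suc zero} {suc (suc zero)} eq = contradiction (F.suc-injective eq) u≢v
    ℓ-injective {suc (suc zero)} {zero} ()
    ℓ-injective {suc (suc zero)} {suc zero} eq = contradiction (sym (F.suc-injective eq)) u≢v
    ℓ-injective {suc (suc zero)} {suc (suc zero)} _ = refl

admissible⇒size : ∀ {k} → 3 ≤ k → ∀ P → Admissible3 P (wheel (suc (suc k))) → suc (suc k) + 3 ≤ length P * 2
admissible⇒size {k} 3≤k P (_ , (τ , lab , fits) , _ , unique)
  with wheelL-surjective (attach (edges (wheel (suc (suc k)))) lab) (map-attach _ lab)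
... | q , s , eq = LowerBound.size 3≤k P τ q s
  (λ v → ↭-trans (↭-reflexive (trans (cong (ends v) (sym eq)) (sym (endLabels-attach (edges (wheel (suc (suc k)))) lab v)))) (fits v)) unique

injective⇒surjective : ∀ {m n} {f : Fin m → Fin n} → m ≡ n → Injective _≡_ _≡_ f → ∀ y → ∃ λ x → f x ≡ y
injective⇒surjective {m} {f = f} refl f-inj y with F.any? (λ x → f x ≟ y)
... | yes hit = hit
... | no miss = contradiction (F.injective⇒≤ {f = g} g-inj) ℕ.1+n≰n
  where
  g : Fin (suc m) → Fin m
  g zero = y
  g (suc x) = f x
  g-inj : Injective _≡_ _≡_ g
  g-inj {zero} {zero} _ = refl
  g-inj {zero} {suc x} eq = contradiction (x , sym eq) miss
  g-inj {suc x} {zero} eq = contradiction (x , eq) miss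
  g-inj {suc x} {suc x′} eq = cong suc (f-inj eq)

injective⇒↔ : ∀ {m n} (f : Fin m → Fin n) → m ≡ n → Injective _≡_ _≡_ f →
              Σ (Fin n ↔ Fin m) λ σ → ∀ x → Inverse.to σ (f x) ≡ x
injective⇒↔ f m≡n f-inj =
  mk↔ₛ′ (proj₁ ∘ surj) f to-f (proj₂ ∘ surj) , to-f
  where
  surj = injective⇒surjective m≡n f-inj
  to-f : ∀ x → proj₁ (surj (f x)) ≡ x
  to-f x = f-inj (proj₂ (surj (f x)))

SameEnds-map : ∀ {m n} (f : Fin m → Fin n) {a b c d} → SameEnds (a , b) (c , d) → SameEnds (f a , f b) (f c , f d)
SameEnds-map f (inj₁ (refl , refl)) = inj₁ (refl , refl)
SameEnds-map f (inj₂ (refl , refl)) = inj₂ (refl , refl)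

-- Handshaking

private
  indicator : ∀ {A : Set} {n} (u : Fin n) (l : A) →
              sum (λ v → length (if ⌊ u ≟ v ⌋ then [ l ] else [])) ≡ 1
  indicator {n = suc n} zero l = cong suc (sum-replicate-zero n)
  indicator {n = suc n} (suc u) l =
    trans (sum-cong-≗ λ v → cong (λ b → length (if b then [ l ] else [])) (⌊suc⌋ v)) (indicator u l)
    where
    ⌊suc⌋ : ∀ v → ⌊ Fin.suc u ≟ suc v ⌋ ≡ ⌊ u ≟ v ⌋
    ⌊suc⌋ v = trans (isYes≗does (suc u ≟ suc v)) (sym (isYes≗does (u ≟ v)))

degree-sum : ∀ {n} (L : List (LEdge n)) → sum (λ v → length (ends v L)) ≡ length L * 2
degree-sum {n} [] = sum-replicate-zero n
degree-sum (((u , w) , l) ∷ L) = trans (sum-cong-≗ λ v → trans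
    (length-++ (firstEnd v e ++ secondEnd v e)) (cong (_+ length (ends v L)) (length-++ (firstEnd v e))))
  (trans (∑-distrib-+ (λ v → length (firstEnd v e) + length (secondEnd v e)) _)
    (cong₂ _+_ (trans (∑-distrib-+ (λ v → length (firstEnd v e)) _)
                      (cong₂ _+_ (indicator u l) (indicator w (comp l))))
               (degree-sum L)))
  where e = (u , w) , l

length-attach : ∀ {n} (es : List (Fin n × Fin n)) lab → length (attach es lab) ≡ length es
length-attach [] lab = refl
length-attach (e ∷ es) lab = cong suc (length-attach es (lab ∘ suc))

handshake : ∀ G lab → sum (λ v → length (endLabels G lab v)) ≡ length (edges G) * 2
handshake G lab = trans (sum-cong-≗ λ v → cong length (endLabels-attach (edges G) lab v))
  (trans (degree-sum (attach (edges G) lab)) (cong (_* 2) (length-attach (edges G) lab)))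

embedding⇒iso : ∀ {G H} → order G ≡ order H →
  (lab-G : Fin (length (edges G)) → Label) (lab-H : Fin (length (edges H)) → Label) →
  (ψ : Fin (order G) → Fin (order H)) → Injective _≡_ _≡_ ψ →
  (∀ v → length (endLabels H lab-H (ψ v)) ≡ length (endLabels G lab-G v)) →
  (∀ a b → SameEnds (lookup (edges G) a) (lookup (edges G) b) → a ≡ b) →
  (∀ a → ∃ λ b → SameEnds (lookup (edges H) b)
                          (ψ (proj₁ (lookup (edges G) a)) , ψ (proj₂ (lookup (edges G) a)))) →
  Iso H G
embedding⇒iso {G} {H} order≡ lab-G lab-H ψ ψ-inj degrees simple image = σ , π , matches
  where
  σ = proj₁ (injective⇒↔ ψ order≡ ψ-inj)
  σ-ψ = proj₂ (injective⇒↔ ψ order≡ ψ-inj)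

  ε : Fin (length (edges G)) → Fin (length (edges H))
  ε a = proj₁ (image a)

  back : ∀ a → SameEnds (Inverse.to σ (proj₁ (lookup (edges H) (ε a))) , Inverse.to σ (proj₂ (lookup (edges H) (ε a))))
                        (lookup (edges G) a)
  back a = subst₂ (λ u w → SameEnds (Inverse.to σ (proj₁ (lookup (edges H) (ε a))) , Inverse.to σ (proj₂ (lookup (edges H) (ε a)))) (u , w))
                  (σ-ψ _) (σ-ψ _) (SameEnds-map (Inverse.to σ) (proj₂ (image a)))

  ε-inj : Injective _≡_ _≡_ ε
  ε-inj {a} {b} eq = simple a b (SameEnds-trans (SameEnds-sym (back a))
    (subst (λ k → SameEnds (Inverse.to σ (proj₁ (lookup (edges H) k)) , Inverse.to σ (proj₂ (lookup (edges H) k))) (lookup (edges G) b))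
           (sym eq) (back b)))

  size≡ : length (edges G) ≡ length (edges H)
  size≡ = ℕ.*-cancelʳ-≡ _ _ 2 (trans (sym (handshake G lab-G)) (trans (sum-cong-≗ (sym ∘ degrees))
    (trans (sym (sum-permute (λ v → length (endLabels H lab-H v)) (flip σ))) (handshake H lab-H))))
    where
    flip : ∀ {A B : Set} → A ↔ B → B ↔ A
    flip f = mk↔ₛ′ (Inverse.from f) (Inverse.to f) (Inverse.strictlyInverseʳ f) (Inverse.strictlyInverseˡ f)

  π = proj₁ (injective⇒↔ ε size≡ ε-inj)

  matches : ∀ k → SameEnds (Inverse.to σ (proj₁ (lookup (edges H) k)) , Inverse.to σ (proj₂ (lookup (edges H) k)))
                           (lookup (edges G) (Inverse.to π k))
  matches k = subst (λ k′ → SameEnds (Inverse.to σ (proj₁ (lookup (edges H) k′)) , Inverse.to σ (proj₂ (lookup (edges H) k′)))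
                                     (lookup (edges G) (Inverse.to π k)))
                    (Inverse.strictlyInverseʳ π k) (back (Inverse.to π k))

-- Half-edges of a realized graph

module HalfEdges (P : Pot) (H : Graph) (τ : Fin (order H) → Fin (length P))
  (lab : Fin (length (edges H)) → Label) (fits : ∀ v → endLabels H lab v ↭ lookup P (τ v)) where

  HalfEdge : Set
  HalfEdge = Fin (length (edges H)) × Bool

  at : HalfEdge → Fin (order H)
  at (k , false) = proj₁ (lookup (edges H) k)
  at (k , true) = proj₂ (lookup (edges H) k)

  label : HalfEdge → Label
  label (k , false) = lab k
  label (k , true) = comp (lab k)

  flip : HalfEdge → HalfEdge
  flip (k , b) = k , not b

  flip-involutive : ∀ h → flip (flip h) ≡ h
  flip-involutive (k , false) = refl
  flip-involutive (k , true) = refl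

  flip-injective : ∀ {h h′} → flip h ≡ flip h′ → h ≡ h′
  flip-injective {h} {h′} eq = trans (sym (flip-involutive h)) (trans (cong flip eq) (flip-involutive h′))

  label-flip : ∀ h → label (flip h) ≡ comp (label h)
  label-flip (k , false) = refl
  label-flip (k , true) = sym (comp-involutive (lab k))

  dest : HalfEdge → Fin (order H)
  dest h = at (flip h)

  edge-of : ∀ h → SameEnds (lookup (edges H) (proj₁ h)) (at h , dest h)
  edge-of (k , false) = inj₁ (refl , refl)
  edge-of (k , true) = inj₂ (refl , refl)

  private
    sides : List Bool
    sides = false ∷ true ∷ []

  halves : Fin (order H) → List HalfEdge
  halves v = filter (λ h → at h ≟ v) (cartesianProduct (allFin (length (edges H))) sides)

  ∈-halves : ∀ h → h ∈ halves (at h)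
  ∈-halves (k , b) = ∈-filter⁺ (λ h → at h ≟ _) (∈-cartesianProduct⁺ (∈-allFin k) (side b)) refl
    where
    side : ∀ b → b ∈ sides
    side false = here refl
    side true = there (here refl)

  at-halves : ∀ {h v} → h ∈ halves v → at h ≡ v
  at-halves {v = v} h∈ = proj₂ (∈-filter⁻ (λ h → at h ≟ v) {xs = cartesianProduct (allFin _) sides} h∈)

  halves-unique : ∀ v → Unique (halves v)
  halves-unique v = filter⁺ (λ h → at h ≟ v) (cartesianProduct⁺ (allFin⁺ _) (((λ ()) ∷ []) ∷ [] ∷ []))

  endLabels-halves : ∀ v → endLabels H lab v ≡ map label (halves v)
  endLabels-halves v = go (allFin _)
    where
    go : ∀ ks → concatMap (λ k → (if ⌊ proj₁ (lookup (edges H) k) ≟ v ⌋ then [ lab k ] else [])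
                              ++ (if ⌊ proj₂ (lookup (edges H) k) ≟ v ⌋ then [ comp (lab k) ] else [])) ks
                ≡ map label (filter (λ h → at h ≟ v) (cartesianProduct ks sides))
    go [] = refl
    go (k ∷ ks) = trans (cong (_ ++_) (go ks)) (trans (++-assoc (if ⌊ at (k , false) ≟ v ⌋ then [ lab k ] else []) _ _)
      (sym (trans (step (k , false) _) (cong ((if ⌊ at (k , false) ≟ v ⌋ then [ lab k ] else []) ++_) (step (k , true) _)))))
      where
      step : ∀ h hs → map label (filter (λ h → at h ≟ v) (h ∷ hs))
                      ≡ (if ⌊ at h ≟ v ⌋ then [ label h ] else []) ++ map label (filter (λ h → at h ≟ v) hs)
      step h hs with at h ≟ v
      ... | yes _ = refl
      ... | no _ = refl

  tile : Fin (order H) → Tile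
  tile v = lookup P (τ v)

  labels-↭ : ∀ v → map label (halves v) ↭ tile v
  labels-↭ v = ↭-trans (↭-reflexive (sym (endLabels-halves v))) (fits v)

  label∈tile : ∀ h → label h ∈ tile (at h)
  label∈tile h = ∈-resp-↭ (labels-↭ (at h)) (∈-map⁺ label (∈-halves h))

  comp∈tile : ∀ {l} h → label h ≡ l → comp l ∈ tile (dest h)
  comp∈tile h refl = subst (_∈ tile (dest h)) (label-flip h) (label∈tile (flip h))

  find : ∀ {v l} → l ∈ tile v → ∃ λ h → at h ≡ v × label h ≡ l
  find {v} l∈ with ∈-map⁻ label (∈-resp-↭ (↭-sym (labels-↭ v)) l∈)
  ... | h , h∈ , eq = h , at-halves h∈ , sym eq

  three : ∀ {v l₁ l₂ l₃} → tile v ≡ l₁ ∷ l₂ ∷ l₃ ∷ [] →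
          ∃ λ h₁ → ∃ λ h₂ → ∃ λ h₃ →
          (label h₁ ≡ l₁ × label h₂ ≡ l₂ × label h₃ ≡ l₃) × halves v ↭ h₁ ∷ h₂ ∷ h₃ ∷ []
  three {v} eq with ↭-map-inv label (↭-trans (labels-↭ v) (↭-reflexive eq))
  ... | h₁ ∷ h₂ ∷ h₃ ∷ [] , refl , p = h₁ , h₂ , h₃ , (refl , refl , refl) , p

  two-distinct : ∀ {v l₁ l₂ l₃} → tile v ≡ l₁ ∷ l₂ ∷ l₃ ∷ [] →
    ∃₂ λ h₁ h₂ → h₁ ≢ h₂ × (at h₁ ≡ v × label h₁ ≡ l₁) × (at h₂ ≡ v × label h₂ ≡ l₂)
  two-distinct {v} eq with three eq
  ... | h₁ , h₂ , h₃ , (eq₁ , eq₂ , _) , p with extract (halves-unique v) h₁∈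
    where h₁∈ = ∈-resp-↭ (↭-sym p) (here refl)
  ... | ys , p′ , (h₁≢ys ∷ _) = h₁ , h₂ , All.lookup h₁≢ys h₂∈ys ,
      (at-halves (∈-resp-↭ (↭-sym p) (here refl)) , eq₁) , (at-halves (∈-resp-↭ (↭-sym p) (there (here refl))) , eq₂)
    where
    h₂∈ys : h₂ ∈ ys
    h₂∈ys = ∈-resp-↭ (drop-∷ (↭-trans (↭-sym p) p′)) (here refl)

  second-unique : ∀ {v l₁ l₂ l₃} → tile v ≡ l₁ ∷ l₂ ∷ l₃ ∷ [] → l₁ ≢ l₂ → l₃ ≢ l₂ →
    ∀ {h h′} → at h ≡ v → label h ≡ l₂ → at h′ ≡ v → label h′ ≡ l₂ → h ≡ h′
  second-unique {v} {l₂ = l₂} eq l₁≢ l₃≢ {h} {h′} at-h lab-h at-h′ lab-h′ with three eq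
  ... | h₁ , h₂ , h₃ , (eq₁ , eq₂ , eq₃) , p = trans (is-h₂ at-h lab-h) (sym (is-h₂ at-h′ lab-h′))
    where
    is-h₂ : ∀ {h} → at h ≡ v → label h ≡ l₂ → h ≡ h₂
    is-h₂ {h} refl lab-h with ∈-resp-↭ p (∈-halves h)
    ... | here refl = contradiction (trans (sym eq₁) lab-h) l₁≢
    ... | there (here h≡h₂) = h≡h₂
    ... | there (there (here refl)) = contradiction (trans (sym eq₃) lab-h) l₃≢

-- The pot.  For δ = 0 the rim has 2c vertices, for δ = 1 it has 2c − 1.

module WheelPot (k c δ : ℕ) (k+δ : suc k + δ ≡ c + c) (δ+2≤c : suc (suc δ) ≤ c) where

  0<c : 0 < c
  0<c = ℕ.≤-trans (s≤s z≤n) δ+2≤c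

  suc-pred-c : suc (ℕ.pred c) ≡ c
  suc-pred-c = ℕ.suc-pred c {{ℕ.>-nonZero 0<c}}

  outer : ℕ → Label
  outer t = if ⌊ t ℕ.<? c ⌋ then (t , false) else (ℕ.pred c , true)

  inner : ℕ → Label
  inner zero = δ , false
  inner (suc t) = t , true

  rimTile : ℕ → Tile
  rimTile t = outer t ∷ inner t ∷ (c , false) ∷ []

  hubTile : Tile
  hubTile = tabulate {n = suc k} λ _ → c , true

  pot : Pot
  pot = hubTile ∷ applyUpTo rimTile (suc c)

  length-pot : length pot ≡ suc (suc c)
  length-pot = cong suc (length-applyUpTo rimTile (suc c))

  outer-< : ∀ {t} → t < c → outer t ≡ (t , false)
  outer-< {t} t<c with t ℕ.<? c
  ... | yes _ = refl
  ... | no t≮c = contradiction t<c t≮c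

  outer-c : outer c ≡ (ℕ.pred c , true)
  outer-c with c ℕ.<? c
  ... | yes c<c = contradiction c<c (ℕ.<-irrefl refl)
  ... | no _ = refl

  outer-cases : ∀ {t} → t ≤ c → (t < c × outer t ≡ (t , false)) ⊎ (t ≡ c × outer t ≡ (ℕ.pred c , true))
  outer-cases {t} t≤c with ℕ.m≤n⇒m<n∨m≡n t≤c
  ... | inj₁ t<c = inj₁ (t<c , outer-< t<c)
  ... | inj₂ refl = inj₂ (refl , outer-c)

  inner-injective : ∀ {t t′} → inner t ≡ inner t′ → t ≡ t′
  inner-injective {zero} {zero} _ = refl
  inner-injective {zero} {suc t′} ()
  inner-injective {suc t} {zero} ()
  inner-injective {suc t} {suc .t} refl = refl

  rimTile-injective : ∀ {t t′} → rimTile t ≡ rimTile t′ → t ≡ t′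
  rimTile-injective eq = inner-injective (∷-injectiveˡ (∷-injectiveʳ eq))

  ∈-hubTile : ∀ {l} → l ∈ hubTile → l ≡ (c , true)
  ∈-hubTile l∈ = proj₂ (∈-tabulate⁻ {f = λ (_ : Fin (suc k)) → c , true} l∈)

  hatted∈rimTile : ∀ {j t} → t ≤ c → (j , true) ∈ rimTile t → t ≡ suc j
  hatted∈rimTile t≤c (here eq) with outer-cases t≤c
  ... | inj₁ (_ , eq′) = contradiction (trans eq eq′) λ ()
  ... | inj₂ (refl , eq′) = trans (sym suc-pred-c) (cong suc (sym (cong proj₁ (trans eq eq′))))
  hatted∈rimTile {t = suc t} t≤c (there (here refl)) = refl
  hatted∈rimTile t≤c (there (there (here ())))

  unhatted∈rimTile : ∀ {j t} → t ≤ c → j < c → (j , false) ∈ rimTile t → t ≡ j ⊎ t ≡ 0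
  unhatted∈rimTile t≤c j<c (here eq) with outer-cases t≤c
  ... | inj₁ (_ , eq′) = inj₁ (sym (cong proj₁ (trans eq eq′)))
  ... | inj₂ (_ , eq′) = contradiction (trans eq eq′) λ ()
  unhatted∈rimTile {t = zero} t≤c j<c (there (here eq)) = inj₂ refl
  unhatted∈rimTile t≤c j<c (there (there (here refl))) = contradiction j<c (ℕ.<-irrefl refl)

  hub∉rimTile : ∀ {t} → t ≤ c → ¬ (c , true) ∈ rimTile t
  hub∉rimTile t≤c l∈ = ℕ.<⇒≱ (ℕ.≤-reflexive (sym (hatted∈rimTile t≤c l∈))) t≤c

  pot-distinct : DistinctTiles pot
  pot-distinct = All.applyUpTo⁺₁ rimTile (suc c) (λ t<c p → hub∉rimTile (ℕ.≤-pred t<c) (∈-resp-↭ p (here refl)))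
    ∷ AllPairs.applyUpTo⁺₁ rimTile (suc c) distinct
    where
    distinct : ∀ {i j} → i < j → j < suc c → ¬ (rimTile i ↭ rimTile j)
    distinct {i} {suc j} i<j j<c p =
      ℕ.<⇒≢ i<j (hatted∈rimTile (ℕ.<⇒≤ (ℕ.<-≤-trans i<j (ℕ.≤-pred j<c))) (∈-resp-↭ (↭-sym p) (there (here refl))))

  -- The type of rim position i is min (i , 2c − i), and 2c − i = suc (δ + (k ∸ i)).
  typ : ℕ → ℕ
  typ i = if ⌊ i ℕ.≤? c ⌋ then i else suc (δ + (k ∸ i))

  typ-low : ∀ {i} → i ≤ c → typ i ≡ i
  typ-low {i} i≤c with i ℕ.≤? c
  ... | yes _ = refl
  ... | no i≰c = contradiction i≤c i≰c

  typ-high : ∀ {i} → c < i → typ i ≡ suc (δ + (k ∸ i))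
  typ-high {i} c<i with i ℕ.≤? c
  ... | yes i≤c = contradiction i≤c (ℕ.<⇒≱ c<i)
  ... | no _ = refl

  mirror : ∀ {i} → i ≤ k → suc (δ + (k ∸ i)) + i ≡ c + c
  mirror {i} i≤k = trans (cong suc (trans (ℕ.+-assoc δ (k ∸ i) i) (trans (cong (δ +_) (ℕ.m∸n+n≡m i≤k)) (ℕ.+-comm δ k)))) k+δ

  mirror-< : ∀ {i} → i ≤ k → c < i → suc (δ + (k ∸ i)) < c
  mirror-< {i} i≤k c<i = ℕ.+-cancelʳ-< i _ c (ℕ.<-≤-trans (ℕ.≤-<-trans (ℕ.≤-reflexive (mirror i≤k)) (ℕ.+-monoʳ-< c c<i)) ℕ.≤-refl)

  c<k : c < k
  c<k = ℕ.+-cancelʳ-≤ δ (suc c) k (ℕ.≤-pred (ℕ.≤-trans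
    (ℕ.≤-reflexive (sym (trans (ℕ.+-suc c (suc δ)) (cong suc (ℕ.+-suc c δ)))))
    (ℕ.≤-trans (ℕ.+-monoʳ-≤ c δ+2≤c) (ℕ.≤-reflexive (sym k+δ)))))

  typ≤c : ∀ {i} → i ≤ k → typ i ≤ c
  typ≤c {i} i≤k with i ℕ.≤? c
  ... | yes i≤c = i≤c
  ... | no i≰c = ℕ.<⇒≤ (mirror-< i≤k (ℕ.≰⇒> i≰c))

  typ-injective : ∀ {i j} → i ≤ k → j ≤ k → typ i ≡ typ j →
                  i ≡ j ⊎ (i ≤ c × c < j × i ≡ suc (δ + (k ∸ j))) ⊎ (j ≤ c × c < i × j ≡ suc (δ + (k ∸ i)))
  typ-injective {i} {j} i≤k j≤k eq with i ℕ.≤? c | j ℕ.≤? c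
  ... | yes _ | yes _ = inj₁ eq
  ... | yes i≤c | no j≰c = inj₂ (inj₁ (i≤c , ℕ.≰⇒> j≰c , eq))
  ... | no i≰c | yes j≤c = inj₂ (inj₂ (j≤c , ℕ.≰⇒> i≰c , sym eq))
  ... | no _ | no _ = inj₁ (ℕ.+-cancelˡ-≡ (suc (δ + (k ∸ i))) i j
          (trans (mirror i≤k) (trans (sym (mirror j≤k)) (cong (_+ j) (sym eq)))))

  -- The label of the edge from rim position i to the next one, at position i.
  out : ℕ → Label
  out i = if ⌊ i ℕ.<? c ⌋ then (i , false) else (δ + (k ∸ i) , true)

  out-< : ∀ {i} → i < c → out i ≡ (i , false)
  out-< {i} i<c with i ℕ.<? c
  ... | yes _ = refl
  ... | no i≮c = contradiction i<c i≮c

  out-≥ : ∀ {i} → c ≤ i → out i ≡ (δ + (k ∸ i) , true)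
  out-≥ {i} c≤i with i ℕ.<? c
  ... | yes i<c = contradiction i<c (ℕ.≤⇒≯ c≤i)
  ... | no _ = refl

  rimLabel hubLabel : Fin (suc k) → Label
  rimLabel h = out (toℕ (prev h))
  hubLabel _ = c , true

  rimTile-fits : ∀ i → out (toℕ i) ∷ comp (rimLabel i) ∷ (c , false) ∷ [] ↭ rimTile (typ (toℕ i))
  rimTile-fits zero = ↭-reflexive (trans (cong₂ (λ l l′ → l ∷ l′ ∷ (c , false) ∷ []) (trans (out-< 0<c) (sym (outer-< 0<c))) last)
                                         (cong rimTile (sym (typ-low {0} z≤n))))
    where
    last : comp (out (toℕ (fromℕ k))) ≡ (δ , false)
    last rewrite F.toℕ-fromℕ k | out-≥ (ℕ.<⇒≤ c<k) | ℕ.n∸n≡0 k | ℕ.+-identityʳ δ = refl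
  rimTile-fits (suc j) rewrite F.toℕ-inject₁ j with ℕ.<-cmp (suc (toℕ j)) c
  ... | tri< i<c _ _
    rewrite out-< i<c | out-< (ℕ.<-trans (ℕ.n<1+n _) i<c) | typ-low (ℕ.<⇒≤ i<c) | outer-< i<c = ↭-refl
  ... | tri≈ _ i≡c _
    rewrite out-≥ (ℕ.≤-reflexive (sym i≡c)) | out-< (ℕ.≤-reflexive i≡c) | typ-low (ℕ.≤-reflexive i≡c) =
      ↭-reflexive (cong (λ l → l ∷ (toℕ j , true) ∷ (c , false) ∷ []) (trans (cong (_, true) half) (sym outer-i)))
    where
    half : δ + (k ∸ suc (toℕ j)) ≡ ℕ.pred c
    half = cong ℕ.pred (ℕ.+-cancelʳ-≡ (suc (toℕ j)) (suc (δ + (k ∸ suc (toℕ j)))) c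
      (trans (mirror (F.toℕ<n j)) (cong (c +_) (sym i≡c))))
    outer-i : outer (suc (toℕ j)) ≡ (ℕ.pred c , true)
    outer-i = trans (cong outer i≡c) outer-c
  ... | tri> _ _ c<i
    rewrite out-≥ (ℕ.<⇒≤ c<i) | out-≥ (ℕ.≤-pred c<i) | typ-high c<i | outer-< (mirror-< (F.toℕ<n j) c<i) =
      ↭-trans (swap _ _ ↭-refl) (↭-reflexive (cong (λ t → (t , false) ∷ (δ + (k ∸ suc (toℕ j)) , true) ∷ (c , false) ∷ [])
        (trans (cong (δ +_) (ℕ.+-∸-assoc 1 (F.toℕ<n j))) (ℕ.+-suc δ (k ∸ suc (toℕ j))))))

  private
    W : Graph
    W = wheel (suc (suc k))

    i≤k : (i : Fin (suc k)) → toℕ i ≤ k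
    i≤k i = ℕ.≤-pred (F.toℕ<n i)

  wheelTile : Fin (suc (suc k)) → Tile
  wheelTile zero = hubTile
  wheelTile (suc i) = rimTile (typ (toℕ i))

  wheel-fits : ∀ v → ends v (wheelL rimLabel hubLabel) ↭ wheelTile v
  wheel-fits zero = ends-hub rimLabel hubLabel
  wheel-fits (suc i) = ↭-trans (ends-rim rimLabel hubLabel i)
    (↭-trans (↭-reflexive (cong (λ j → out (toℕ j) ∷ comp (rimLabel i) ∷ (c , false) ∷ []) (prev-next i)))
             (rimTile-fits i))

  wheelTile∈pot : ∀ v → wheelTile v ∈ pot
  wheelTile∈pot zero = here refl
  wheelTile∈pot (suc i) = there (∈-applyUpTo⁺ rimTile (s≤s (typ≤c (i≤k i))))

  wheel-realized : ∃ λ lab → (∀ v → endLabels W lab v ↭ wheelTile v)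
  wheel-realized = subst (λ es → ∃ λ lab → ∀ v → endLabels (record { order = suc (suc k) ; edges = es }) lab v ↭ wheelTile v)
    (edges-wheelL rimLabel hubLabel)
    (labels L , λ v → ↭-trans (↭-reflexive (endLabels-graph L v)) (wheel-fits v))
    where L = wheelL rimLabel hubLabel

  realizes-wheel : Realizes pot W
  realizes-wheel = (λ v → Any.index (wheelTile∈pot v)) , proj₁ wheel-realized ,
    λ v → ↭-trans (proj₂ wheel-realized v) (↭-reflexive (lookup-index (wheelTile∈pot v)))

  module Uniqueness (H : Graph) (τ : Fin (order H) → Fin (length pot))
    (lab : Fin (length (edges H)) → Label) (fits : ∀ v → endLabels H lab v ↭ lookup pot (τ v)) where

    open HalfEdges pot H τ lab fits

    Rim : Fin (order H) → ℕ → Set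
    Rim v t = tile v ≡ rimTile t

    Hub : Fin (order H) → Set
    Hub v = tile v ≡ hubTile

    kind : ∀ v → Hub v ⊎ ∃ λ t → t ≤ c × Rim v t
    kind v with ∈-lookup {xs = pot} (τ v)
    ... | here eq = inj₁ eq
    ... | there t∈ with ∈-applyUpTo⁻ rimTile t∈
    ... | t , s≤s t≤c , eq = inj₂ (t , t≤c , eq)

    hub∌rim : ∀ {v t} → t ≤ c → Hub v → ¬ Rim v t
    hub∌rim t≤c hub rim = hub∉rimTile t≤c (subst ((c , true) ∈_) (trans (sym hub) rim) (here refl))

    Rim-functional : ∀ {v t t′} → Rim v t → Rim v t′ → t ≡ t′
    Rim-functional rim rim′ = rimTile-injective (trans (sym rim) rim′)

    dest-of-spoke : ∀ h → label h ≡ (c , false) → Hub (dest h)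
    dest-of-spoke h lab-h with kind (dest h)
    ... | inj₁ hub = hub
    ... | inj₂ (t , t≤c , rim) = contradiction (subst ((c , true) ∈_) rim (comp∈tile h lab-h)) (hub∉rimTile t≤c)

    dest-forward : ∀ h {i} → label h ≡ (i , false) → i < c → Rim (dest h) (suc i)
    dest-forward h lab-h i<c with kind (dest h)
    ... | inj₁ hub = contradiction (cong proj₁ (∈-hubTile (subst (_ ∈_) hub (comp∈tile h lab-h)))) (ℕ.<⇒≢ i<c)
    ... | inj₂ (t , t≤c , rim) = subst (Rim (dest h)) (hatted∈rimTile t≤c (subst (_ ∈_) rim (comp∈tile h lab-h))) rim

    dest-backward : ∀ h {i} → label h ≡ (i , true) → i < c → Rim (dest h) i ⊎ Rim (dest h) 0
    dest-backward h lab-h i<c with kind (dest h)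
    ... | inj₁ hub = contradiction (∈-hubTile (subst (_ ∈_) hub (comp∈tile h lab-h))) λ ()
    ... | inj₂ (t , t≤c , rim) with unhatted∈rimTile t≤c i<c (subst (_ ∈_) rim (comp∈tile h lab-h))
    ... | inj₁ refl = inj₁ rim
    ... | inj₂ refl = inj₂ rim

    rim⇒hub : ∀ {v t} → Rim v t → ∃ Hub
    rim⇒hub rim with find (subst (_ ∈_) (sym rim) (there (there (here refl))))
    ... | h , _ , lab-h = dest h , dest-of-spoke h lab-h

    rim⇒root : ∀ t {v} → t ≤ c → Rim v t → ∃ λ r → Rim r 0
    rim⇒root zero _ rim = _ , rim
    rim⇒root (suc t) t<c rim with find (subst (_ ∈_) (sym rim) (there (here refl)))
    ... | h , _ , lab-h with dest-backward h lab-h t<c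
    ... | inj₁ rim′ = rim⇒root t (ℕ.<⇒≤ t<c) rim′
    ... | inj₂ root = _ , root

    hub-and-root : Fin (order H) → ∃ Hub × ∃ λ r → Rim r 0
    hub-and-root v with kind v
    ... | inj₂ (t , t≤c , rim) = rim⇒hub rim , rim⇒root t t≤c rim
    ... | inj₁ hub with find (subst ((c , true) ∈_) (sym hub) (here refl))
    ... | h , _ , lab-h with kind (dest h)
    ... | inj₁ hub′ = contradiction (∈-hubTile (subst (_ ∈_) hub′ (comp∈tile h lab-h))) λ ()
    ... | inj₂ (t , t≤c , rim) = rim⇒hub rim , rim⇒root t t≤c rim

    first-of : ∀ v → ∃ λ h → at h ≡ v × (∀ {t} → t ≤ c → Rim v t → label h ≡ outer t)
    first-of v with kind v
    ... | inj₂ (t , _ , rim) with find (subst (_ ∈_) (sym rim) (here refl))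
    ... | h , at-h , lab-h = h , at-h , λ _ rim′ → trans lab-h (cong outer (Rim-functional rim rim′))
    first-of v | inj₁ hub with find (subst ((c , true) ∈_) (sym hub) (here refl))
    ... | h , at-h , _ = h , at-h , λ t≤c rim → contradiction rim (hub∌rim t≤c hub)

    first : Fin (order H) → HalfEdge
    first v = proj₁ (first-of v)

    arm : HalfEdge → ℕ → HalfEdge
    arm h zero = h
    arm h (suc j) = first (dest (arm h j))

    at-arm-suc : ∀ h j → at (arm h (suc j)) ≡ dest (arm h j)
    at-arm-suc h j = proj₁ (proj₂ (first-of (dest (arm h j))))

    arm-label : ∀ h {i} j → label h ≡ (i , false) → i + j < c → label (arm h j) ≡ (i + j , false)
    arm-label h {i} zero lab-h _ = trans lab-h (cong (_, false) (sym (ℕ.+-identityʳ i)))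
    arm-label h {i} (suc j) lab-h i+j<c =
      trans (proj₂ (proj₂ (first-of (dest (arm h j)))) (ℕ.<⇒≤ lt) here-rim)
            (trans (outer-< lt) (cong (_, false) (sym (ℕ.+-suc i j))))
      where
      lt : suc (i + j) < c
      lt = subst (_< c) (ℕ.+-suc i j) i+j<c
      here-rim : Rim (dest (arm h j)) (suc (i + j))
      here-rim = dest-forward (arm h j) (arm-label h j lab-h (ℕ.<⇒≤ lt)) (ℕ.<⇒≤ lt)

    arm-dest : ∀ h {i} j → label h ≡ (i , false) → i + j < c → Rim (dest (arm h j)) (suc (i + j))
    arm-dest h j lab-h i+j<c = dest-forward (arm h j) (arm-label h j lab-h i+j<c) i+j<c

    module Rooted (hub r : Fin (order H)) (is-hub : Hub hub) (root : Rim r 0)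
      (α β : HalfEdge) (α≢β : α ≢ β)
      (at-α : at α ≡ r) (lab-α : label α ≡ (0 , false))
      (at-β : at β ≡ r) (lab-β : label β ≡ (δ , false)) where

      arms-disjoint : ∀ b → suc (δ + b) < c → dest (arm α (δ + b)) ≢ dest (arm β b)
      arms-disjoint b lt eq = before b lt (flip-injective (second-unique (arm-dest α (δ + b) lab-α (ℕ.<⇒≤ lt))
          (λ eq′ → case trans (sym (outer-< lt)) eq′ of λ ()) (λ ())
          refl (trans (label-flip (arm α (δ + b))) (cong comp (arm-label α (δ + b) lab-α (ℕ.<⇒≤ lt))))
          (sym eq) (trans (label-flip (arm β b)) (cong comp (arm-label β b lab-β (ℕ.<⇒≤ lt))))))
        where
        not-β : ∀ a → a < c → arm α a ≢ β
        not-β zero _ = α≢β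
        not-β (suc a) a<c eq = case Rim-functional (subst (λ v → Rim v (suc a)) at≡ (arm-dest α a lab-α (ℕ.<⇒≤ a<c))) root of λ ()
          where
          at≡ : dest (arm α a) ≡ r
          at≡ = trans (sym (at-arm-suc α a)) (trans (cong at eq) at-β)

        before : ∀ b → suc (δ + b) < c → arm α (δ + b) ≢ arm β b
        before zero lt = not-β (δ + 0) (ℕ.<⇒≤ lt)
        before (suc b) lt eq = arms-disjoint b (ℕ.<⇒≤ (subst (λ a → suc a < c) (ℕ.+-suc δ b) lt))
          (trans (sym (at-arm-suc α (δ + b))) (trans (cong at (trans (cong (arm α) (sym (ℕ.+-suc δ b))) eq)) (at-arm-suc β b)))

      rimVertex : ℕ → Fin (order H)
      rimVertex zero = r
      rimVertex (suc i) = if ⌊ suc i ℕ.≤? c ⌋ then dest (arm α i) else dest (arm β (k ∸ suc i))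

      rimVertex-low : ∀ {i} → suc i ≤ c → rimVertex (suc i) ≡ dest (arm α i)
      rimVertex-low {i} i≤c with suc i ℕ.≤? c
      ... | yes _ = refl
      ... | no i≰c = contradiction i≤c i≰c

      rimVertex-high : ∀ {i} → c < i → rimVertex i ≡ dest (arm β (k ∸ i))
      rimVertex-high {suc i} c<i with suc i ℕ.≤? c
      ... | yes i≤c = contradiction i≤c (ℕ.<⇒≱ c<i)
      ... | no _ = refl

      rimVertex-type : ∀ i → i ≤ k → Rim (rimVertex i) (typ i)
      rimVertex-type zero _ = subst (Rim r) (sym (typ-low {0} z≤n)) root
      rimVertex-type (suc i) i≤k = by-side (ℕ.≤-<-connex (suc i) c)
        where
        by-side : suc i ≤ c ⊎ c < suc i → Rim (rimVertex (suc i)) (typ (suc i))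
        by-side (inj₁ i≤c) = subst₂ Rim (sym (rimVertex-low i≤c)) (sym (typ-low i≤c)) (arm-dest α i lab-α i≤c)
        by-side (inj₂ c<i) = subst₂ Rim (sym (rimVertex-high c<i)) (sym (typ-high c<i))
          (arm-dest β (k ∸ suc i) lab-β (ℕ.<⇒≤ (mirror-< i≤k c<i)))

      ψ : Fin (suc (suc k)) → Fin (order H)
      ψ zero = hub
      ψ (suc i) = rimVertex (toℕ i)

      ψ-tile : ∀ v → tile (ψ v) ≡ wheelTile v
      ψ-tile zero = is-hub
      ψ-tile (suc i) = rimVertex-type (toℕ i) (i≤k i)

      rimVertex-cross : ∀ {i j} → j ≤ k → i ≤ c → c < j → i ≡ suc (δ + (k ∸ j)) → rimVertex i ≢ rimVertex j
      rimVertex-cross {j = j} j≤k i≤c c<j refl eq = arms-disjoint (k ∸ j) (mirror-< j≤k c<j)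
        (trans (sym (rimVertex-low i≤c)) (trans eq (rimVertex-high c<j)))

      rimVertex-injective : ∀ {i j} → i ≤ k → j ≤ k → rimVertex i ≡ rimVertex j → i ≡ j
      rimVertex-injective {i} {j} i≤k j≤k eq
        with typ-injective i≤k j≤k (Rim-functional (subst (λ v → Rim v (typ i)) eq (rimVertex-type i i≤k)) (rimVertex-type j j≤k))
      ... | inj₁ i≡j = i≡j
      ... | inj₂ (inj₁ (i≤c , c<j , i≡)) = contradiction eq (rimVertex-cross j≤k i≤c c<j i≡)
      ... | inj₂ (inj₂ (j≤c , c<i , j≡)) = contradiction (sym eq) (rimVertex-cross i≤k j≤c c<i j≡)

      ψ-rim-not-hub : ∀ i → ¬ Hub (ψ (suc i))
      ψ-rim-not-hub i is-hub′ = hub∌rim (typ≤c (i≤k i)) is-hub′ (ψ-tile (suc i))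

      ψ-injective : Injective _≡_ _≡_ ψ
      ψ-injective {zero} {zero} _ = refl
      ψ-injective {zero} {suc j} eq = contradiction (subst Hub eq is-hub) (ψ-rim-not-hub j)
      ψ-injective {suc i} {zero} eq = contradiction (subst Hub (sym eq) is-hub) (ψ-rim-not-hub i)
      ψ-injective {suc i} {suc j} eq = cong suc (F.toℕ-injective (rimVertex-injective (i≤k i) (i≤k j) eq))

      module Tight (order≡ : suc (suc k) ≡ order H) where

        ψ-surjective : ∀ v → ∃ λ x → ψ x ≡ v
        ψ-surjective = injective⇒surjective order≡ ψ-injective

        private
          end≡c : suc (δ + (k ∸ c)) ≡ c
          end≡c = ℕ.+-cancelʳ-≡ c _ c (mirror (ℕ.<⇒≤ c<k))

          end-rim : Rim (dest (arm β (k ∸ c))) (suc (δ + (k ∸ c)))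
          end-rim = arm-dest β (k ∸ c) lab-β (ℕ.≤-reflexive end≡c)

        -- Both arms end in a vertex of type c, and there is room for only one.
        arms-meet : dest (arm β (k ∸ c)) ≡ rimVertex c
        arms-meet with ψ-surjective (dest (arm β (k ∸ c)))
        ... | zero , eq = contradiction (subst (λ v → Rim v _) (sym eq) end-rim) (hub∌rim (ℕ.≤-reflexive end≡c) is-hub)
        ... | suc i , eq = trans (sym eq) (cong rimVertex i≡c)
          where
          typ-i : typ (toℕ i) ≡ typ c
          typ-i = trans (Rim-functional (subst (λ v → Rim v (typ (toℕ i))) eq (rimVertex-type (toℕ i) (i≤k i))) end-rim)
                        (trans end≡c (sym (typ-low ℕ.≤-refl)))
          i≡c : toℕ i ≡ c
          i≡c with typ-injective (i≤k i) (ℕ.<⇒≤ c<k) typ-i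
          ... | inj₁ i≡c = i≡c
          ... | inj₂ (inj₁ (_ , c<c , _)) = contradiction c<c (ℕ.<-irrefl refl)
          ... | inj₂ (inj₂ (_ , c<i , c≡)) = contradiction (sym c≡) (ℕ.<⇒≢ (mirror-< (i≤k i) c<i))

        rimVertex-arm-β : ∀ {i} → c ≤ i → dest (arm β (k ∸ i)) ≡ rimVertex i
        rimVertex-arm-β c≤i with ℕ.m≤n⇒m<n∨m≡n c≤i
        ... | inj₁ c<i = sym (rimVertex-high c<i)
        ... | inj₂ refl = arms-meet

        rim-step : ∀ i → i < k → ∃ λ h → at h ≡ rimVertex i × dest h ≡ rimVertex (suc i)
        rim-step i i<k with ℕ.≤-<-connex (suc i) c
        ... | inj₁ i<c = arm α i , start i i<c , sym (rimVertex-low i<c)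
          where
          start : ∀ i → i < c → at (arm α i) ≡ rimVertex i
          start zero _ = at-α
          start (suc i) i<c = trans (at-arm-suc α i) (sym (rimVertex-low (ℕ.<⇒≤ i<c)))
        ... | inj₂ c<i = flip (arm β (k ∸ i)) , rimVertex-arm-β (ℕ.≤-pred c<i) ,
          trans (cong at (flip-involutive (arm β (k ∸ i))))
            (trans (cong (at ∘ arm β) (ℕ.+-∸-assoc 1 i<k))
              (trans (at-arm-suc β (k ∸ suc i)) (rimVertex-arm-β (ℕ.<⇒≤ c<i))))

        Joined : Fin (suc (suc k)) × Fin (suc (suc k)) → Set
        Joined (u , w) = ∃ λ h → at h ≡ ψ u × dest h ≡ ψ w

        rim-joined : ∀ i → Joined (rim i)
        rim-joined zero = flip β ,
          trans (cong (dest ∘ arm β) (sym (ℕ.n∸n≡0 k))) (trans (rimVertex-arm-β (ℕ.<⇒≤ c<k)) (cong rimVertex (sym (F.toℕ-fromℕ k)))) ,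
          trans (cong at (flip-involutive β)) at-β
        rim-joined (suc i) with rim-step (toℕ i) (F.toℕ<n i)
        ... | h , at-h , dest-h = h , trans at-h (cong rimVertex (sym (F.toℕ-inject₁ i))) , dest-h

        spoke-joined : ∀ i → Joined (spoke i)
        spoke-joined i with find (subst ((c , false) ∈_) (sym (ψ-tile (suc i))) (there (there (here refl))))
        ... | h , at-h , lab-h with ψ-surjective (dest h)
        ... | zero , eq = flip h , sym eq , trans (cong at (flip-involutive h)) at-h
        ... | suc j , eq = contradiction (subst Hub (sym eq) (dest-of-spoke h lab-h)) (ψ-rim-not-hub j)

        edge-joined : ∀ {e} → e ∈ edges W → Joined e
        edge-joined e∈ with ∈-++⁻ (map (rim ∘ suc) (allFin k)) e∈
        ... | inj₂ (here refl) = rim-joined zero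
        ... | inj₁ e∈rims with ∈-map⁻ (rim ∘ suc) e∈rims
        ... | i , _ , refl = rim-joined (suc i)
        edge-joined e∈ | inj₂ (there e∈spokes) with ∈-map⁻ spoke e∈spokes
        ... | i , _ , refl = spoke-joined i

        iso : Iso H W
        iso = embedding⇒iso {W} {H} order≡ (proj₁ wheel-realized) lab ψ ψ-injective
          (λ v → trans (↭-length (fits (ψ v))) (trans (cong length (ψ-tile v)) (sym (↭-length (proj₂ wheel-realized v)))))
          (wheel-simple (ℕ.≤-trans (ℕ.≤-trans (s≤s (s≤s z≤n)) δ+2≤c) (ℕ.<⇒≤ c<k)))
          (λ a → image (lookup (edges W) a) (edge-joined (∈-lookup {xs = edges W} a)))
          where
          image : ∀ e → Joined e → ∃ λ b → SameEnds (lookup (edges H) b) (ψ (proj₁ e) , ψ (proj₂ e))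
          image e (h , at-h , dest-h) = proj₁ h , subst₂ (λ u w → SameEnds (lookup (edges H) (proj₁ h)) (u , w)) at-h dest-h (edge-of h)

    rooted : Fin (order H) → Σ (Fin (suc (suc k)) → Fin (order H)) λ ψ →
             Injective _≡_ _≡_ ψ × (suc (suc k) ≡ order H → Iso H W)
    rooted v with hub-and-root v
    ... | (hub , is-hub) , (r , root) with two-distinct root
    ... | α , β , α≢β , (at-α , lab-α) , (at-β , lab-β) = ψ , ψ-injective , Tight.iso
      where open Rooted hub r is-hub root α β α≢β at-α (trans lab-α (outer-< 0<c)) at-β lab-β

  pot-admissible : Admissible3 pot W
  pot-admissible = pot-distinct , realizes-wheel , minimal , unique
    where
    minimal : ∀ H → 1 ≤ order H → Realizes pot H → suc (suc k) ≤ order H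
    minimal H 1≤ (τ , lab , fits) = F.injective⇒≤ (proj₁ (proj₂ (Uniqueness.rooted H τ lab fits (F.fromℕ< 1≤))))
    unique : ∀ H → Realizes pot H → order H ≡ suc (suc k) → Iso H W
    unique H (τ , lab , fits) eq =
      proj₂ (proj₂ (Uniqueness.rooted H τ lab fits (F.fromℕ< (subst (0 <_) (sym eq) z<s)))) (sym eq)

double : ∀ c → c * 2 ≡ c + c
double c = trans (ℕ.*-comm c 2) (cong (c +_) (ℕ.+-identityʳ c))

halves-of : ∀ n → n ≡ n / 2 + n / 2 ⊎ n ≡ suc (n / 2 + n / 2)
halves-of n with n % 2 | m≡m%n+[m/n]*n n 2 | m%n<n n 2
... | zero | eq | _ = inj₁ (trans eq (double (n / 2)))
... | suc zero | eq | _ = inj₂ (trans eq (cong suc (double (n / 2))))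
... | suc (suc _) | _ | s≤s (s≤s ())

half-≤ : ∀ {a b} → a + a ≤ suc (b + b) → a ≤ b
half-≤ {a} {b} le = ℕ.≮⇒≥ λ b<a → ℕ.<⇒≱ (ℕ.≤-trans (ℕ.≤-reflexive (cong suc (sym (ℕ.+-suc b b)))) (ℕ.+-mono-≤ b<a b<a)) le

optimal-pot : ∀ k → 3 ≤ k → let n = suc (suc k) in Σ Pot λ P → Admissible3 P (wheel n) × length P ≡ n / 2 + 2
optimal-pot k 3≤k with halves-of (suc (suc k))
... | inj₁ eq = pot , pot-admissible , trans length-pot (ℕ.+-comm 2 c)
  where
  c = suc (suc k) / 2
  open WheelPot k c 1 (trans (ℕ.+-comm (suc k) 1) eq)
    (half-≤ (s≤s (ℕ.≤-trans (s≤s (s≤s 3≤k)) (ℕ.≤-reflexive eq))))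
... | inj₂ eq = pot , pot-admissible , trans length-pot (ℕ.+-comm 2 c)
  where
  c = suc (suc k) / 2
  open WheelPot k c 0 (trans (ℕ.+-identityʳ (suc k)) (ℕ.suc-injective eq))
    (half-≤ (ℕ.≤-trans (s≤s 3≤k) (ℕ.≤-trans (ℕ.n≤1+n _) (ℕ.≤-reflexive eq))))

size⇒bound : ∀ n K → n + 3 ≤ K * 2 → n / 2 + 2 ≤ K
size⇒bound n K le = ℕ.≤-pred (ℕ.*-cancelʳ-< 2 (n / 2 + 2) (suc K) (begin-strict
  (n / 2 + 2) * 2    ≡⟨ ℕ.*-distribʳ-+ 2 (n / 2) 2 ⟩
  n / 2 * 2 + 4      ≤⟨ ℕ.+-monoˡ-≤ 4 (m/n*n≤m n 2) ⟩
  n + 4              ≡⟨ ℕ.+-suc n 3 ⟩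
  suc (n + 3)        ≤⟨ s≤s le ⟩
  suc (K * 2)        <⟨ ℕ.n<1+n _ ⟩
  suc K * 2          ∎))
  where open ℕ.≤-Reasoning

theorem4 : (n : ℕ) → 4 < n → T3Is (wheel n) (n / 2 + 2)
theorem4 (suc (suc k)) (s≤s (s≤s 3≤k)) =
  optimal-pot k 3≤k , λ P adm → size⇒bound (suc (suc k)) (length P) (admissible⇒size 3≤k P adm)
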